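{- Let $r\geq 1$, $H=\mathbb{F}_2^r$, $n=|H|=2^r$, and let $C(z)=(z_{a+b})_{a,b\in H}$ be the group circulant in commuting variables $(z_x)_{x\in H}$. Let $\mathbf m=(m_x)_{x\in H}$ be a vector of nonnegative integers with $|\mathbf m|=\sum_{x\in H}m_x=n$. Then: (i) if $\sigma(\mathbf m)\neq 0$, then $[z^{\mathbf m}]\det C(z)=0$; (ii) if $\sigma(\mathbf m)=0$, then $$\nu_2\bigl([z^{\mathbf m}]\det C(z)\bigr)=\nu_2\!\left(\frac{n!}{\mathbf m!}\right),$$ and in particular $[z^{\mathbf m}]\det C(z)\neq 0$.
   Context: Rows and columns of $C(z)$ are indexed by $H$ in one common fixed order, and the determinant is taken over $\mathbb{Z}[z_x:x\in H]$. Notation: $z^{\mathbf m}=\prod_{x\in H}z_x^{m_x}$, $\mathbf m!=\prod_{x\in H}m_x!$, $\sigma(\mathbf m)=\sum_{x\in H}m_x x\in H$, and $[z^{\mathbf m}]F$ is the (integer) coefficient of $z^{\mathbf m}$ in $F$. For a nonzero integer $a$, $\nu_2(a)$ is the exponent of $2$ in $a$, and $\nu_2(0)=+\infty$. -}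

module Defs where

open import Algebra.Bundles.Raw using (RawMonoid; RawRing)
import Algebra.Definitions.RawMonoid as MonoidOps
import Algebra.Definitions.RawSemiring as SemiringOps
open import Data.Bool.Base using (if_then_else_)
open import Data.Fin.Base using (Fin; zero; suc; toℕ; punchIn)
open import Data.Integer.Base as ℤ using (ℤ; 0ℤ; 1ℤ)
open import Data.List.Base using (List; []; _∷_; [_]; _++_; map; foldr; filter; cartesianProductWith)
open import Data.List.Relation.Unary.All as All using (All; all?)
import Data.List.Relation.Unary.All.Properties as All
open import Data.Nat.Base as ℕ using (ℕ; zero; suc; NonZero; _^_; _/_; _!)
open import Data.Nat.Divisibility using (_∣?_)
open import Data.Nat.ListAction using (sum; product)
open import Data.Nat.ListAction.Properties using (product≢0)
open import Data.Nat.Properties using (_!≢0; _≟_)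
open import Data.Parity.Base as ℙ using (Parity; 0ℙ; 1ℙ)
import Data.Parity.Properties as ℙ
open import Data.Product.Base using (_×_; _,_; proj₁; proj₂)
open import Data.Vec.Base as Vec using (Vec; []; _∷_; zipWith; replicate)
open import Data.Vec.Properties using (≡-dec)
open import Function.Bundles using (_↔_; Inverse)
open import Level using (0ℓ)
open import Relation.Binary.Definitions using (DecidableEquality)
open import Relation.Binary.PropositionalEquality using (_≡_)
open import Relation.Nullary.Construct.Add.Supremum using (_⁺; ⊤⁺) renaming ([_] to fin)
open import Relation.Nullary.Decidable using (Dec; yes; no; ⌊_⌋)

-- H r is 𝔽₂^r, with Parity as the two-element field.

H : ℕ → Set
H r = Vec Parity r

infixl 6 _⊕_

_⊕_ : ∀ {r} → H r → H r → H r
_⊕_ = zipWith ℙ._+_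

𝟎 : ∀ {r} → H r
𝟎 = replicate _ 0ℙ

H-rawMonoid : ℕ → RawMonoid 0ℓ 0ℓ
H-rawMonoid r = record { Carrier = H r ; _≈_ = _≡_ ; _∙_ = _⊕_ ; ε = 𝟎 }

_≟ᴴ_ : ∀ {r} → DecidableEquality (H r)
_≟ᴴ_ = ≡-dec ℙ._≟_

elements : ∀ r → List (H r)
elements zero    = [ [] ]
elements (suc r) = map (0ℙ ∷_) (elements r) ++ map (1ℙ ∷_) (elements r)

Exponent : ℕ → Set
Exponent r = H r → ℕ

module _ {r : ℕ} where

  degree : Exponent r → ℕ
  degree m = sum (map m (elements r))

  ∏! : Exponent r → ℕ
  ∏! m = product (map (λ x → m x !) (elements r))

  ∏!-nonZero : ∀ m → NonZero (∏! m)
  ∏!-nonZero m = product≢0 (All.map⁺ (All.universal (λ x → m x !≢0) (elements r)))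

  -- The division is exact when degree m ≡ n.
  _!/∏!_ : ℕ → Exponent r → ℕ
  n !/∏! m = (n ! / ∏! m) {{∏!-nonZero m}}

  σ : Exponent r → H r
  σ m = foldr _⊕_ 𝟎 (map (λ x → m x · x) (elements r))
    where open MonoidOps (H-rawMonoid r) renaming (_×_ to _·_)

  Agree : Exponent r → Exponent r → Set
  Agree e m = All (λ x → e x ≡ m x) (elements r)

  agree? : ∀ e m → Dec (Agree e m)
  agree? e m = all? (λ x → e x ≟ m x) (elements r)

-- ℤ[z_x : x ∈ H r].  A polynomial is a formal sum of terms c · z^e in which
-- exponents may repeat; two such sums are equal (_≈_ in polyRing) when all
-- their coefficients agree.

Poly : ℕ → Set
Poly r = List (ℤ × Exponent r)

module _ {r : ℕ} where

  coeff : Exponent r → Poly r → ℤ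
  coeff m p = foldr ℤ._+_ 0ℤ (map proj₁ (filter (λ t → agree? (proj₂ t) m) p))

  var : H r → Poly r
  var x = [ 1ℤ , (λ y → if ⌊ x ≟ᴴ y ⌋ then 1 else 0) ]

  mulTerm : ℤ × Exponent r → ℤ × Exponent r → ℤ × Exponent r
  mulTerm (c , e) (d , f) = c ℤ.* d , (λ x → e x ℕ.+ f x)

polyRing : ℕ → RawRing 0ℓ 0ℓ
polyRing r = record
  { Carrier = Poly r
  ; _≈_     = λ p q → ∀ m → coeff m p ≡ coeff m q
  ; _+_     = _++_
  ; _*_     = cartesianProductWith mulTerm
  ; -_      = map (λ (c , e) → ℤ.- c , e)
  ; 0#      = []
  ; 1#      = [ 1ℤ , (λ _ → 0) ]
  }

module Determinant {c ℓ} (R : RawRing c ℓ) where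
  open RawRing R
  open SemiringOps rawSemiring using () renaming (sum to Σ[_]; _^_ to _↑_)

  Matrix : ℕ → Set c
  Matrix n = Fin n → Fin n → Carrier

  minor : ∀ {n} → Matrix (suc n) → Fin (suc n) → Matrix n
  minor M j i k = M (suc i) (punchIn j k)

  -- Cofactor expansion along the first row.
  det : ∀ {n} → Matrix n → Carrier
  det {zero}  M = 1#
  det {suc n} M = Σ[ (λ j → ((- 1#) ↑ toℕ j) * (M zero j * det (minor M j))) ]

-- The order in which rows and columns are indexed by H r is a parameter.

module _ {r : ℕ} (order : Fin (2 ^ r) ↔ H r) where
  open Inverse order using (to)
  open Determinant (polyRing r)

  circulant : Matrix (2 ^ r)
  circulant i j = var (to i ⊕ to j)

  detC : Poly r
  detC = det circulant

-- The largest j ≤ k with 2 ^ j ∣ a.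
exponent₂≤ : ℕ → ℕ → ℕ
exponent₂≤ zero    a = 0
exponent₂≤ (suc k) a with 2 ^ suc k ∣? a
... | yes _ = suc k
... | no  _ = exponent₂≤ k a

-- The search bound ∣ a ∣ loses nothing: if a ≢ 0, then 2 ^ j ∣ a forces j < ∣ a ∣.
ν₂ : ℤ → ℕ ⁺
ν₂ a with ℤ.∣ a ∣
... | zero  = ⊤⁺
... | suc k = fin (exponent₂≤ (suc k) (suc k))

-- With X = ((−1)^(a·b)) one has X C = Λ X and X² = n I, hence det C is the product of
-- the linear forms λ_a = Σₓ (−1)^(a·x) zₓ.  Read as an exponential generating
-- function, P_r = ∏ λ_a takes the value 𝐦! [z^𝐦] det C on a list with multiplicities 𝐦.
-- Splitting the characters of H (r+1) by their first bit gives P_{r+1} = Q · Q′, where Q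
-- is P_r of the tails and Q′ is Q twisted by the sign of the first bits.  The splittings
-- of a list contributing to Q · Q′ pair up, which yields one factor 2; the cofactor
-- counts, modulo 2, the n-element sublists with tail sum 0 containing a given element
-- of a list of length 2n with sum 0.  The indicator of "sum 0" is a product of r affine
-- functions over 𝔽₂, and every set of at most r < n of the remaining 2n − 1 elements
-- lies in an odd number of (n − 1)-element sublists of them, so this count is odd.
-- Hence P_r = 2^(n−1) · odd on lists of length n and sum 0, and P_r = 0 elsewhere;
-- finally ν₂(n!) = n − 1.

module Submission where

open import Defs
open import Algebra.Bundles using (CommutativeRing)
open import Algebra.Bundles.Raw using (RawRing)
import Algebra.Definitions.RawMonoid as MonoidOps
import Algebra.Definitions.RawSemiring as SemiringOps
import Algebra.Properties.CommutativeMonoid.Sum as CommutativeMonoidSum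
import Algebra.Properties.Semiring.Sum as SemiringSum
open import Algebra.Structures using (IsCommutativeMonoid; IsCommutativeRing)
open import Data.Bool.Base using (Bool; true; false; if_then_else_)
open import Data.Empty using (⊥)
open import Data.Fin.Base using (Fin; zero; suc; toℕ; punchIn; _↑ˡ_; _↑ʳ_)
open import Data.Fin.Properties as Fin using (+↔⊎; splitAt-↑ˡ; splitAt-↑ʳ; punchInᵢ≢i)
open import Data.Integer.Base as ℤ using (ℤ; 0ℤ; 1ℤ; -1ℤ; -[1+_]; _⊖_; +_)
import Data.Integer.Properties as ℤ
open import Data.List.Base using (List; []; _∷_; _++_; map; foldr; concatMap; replicate; length)
open import Data.List.Membership.Propositional using (_∈_)
open import Data.List.Membership.Propositional.Properties using (∈-++⁺ˡ; ∈-++⁺ʳ; ∈-map⁺)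
open import Data.List.Properties using (length-map; length-++; length-replicate; map-++; map-∘; map-cong)
open import Data.List.Relation.Unary.All as All using (All)
open import Data.List.Relation.Unary.Any using (here)
open import Data.Nat.Base as ℕ using (ℕ; zero; suc; _≥_; _≤_; _^_; _!; _∸_; parity)
open import Data.Nat.Combinatorics using (k![n∸k]!∣n!)
open import Data.Nat.Divisibility using (_∣_; divides; _∣?_; ∣-refl; ∣-trans; *-monoʳ-∣; m∣m*n)
open import Data.Nat.DivMod using (m*[n/m]≡n)
open import Data.Nat.ListAction using (sum; product)
import Data.Nat.Properties as ℕ
open import Data.Nat.Tactic.RingSolver using (solve-∀)
open import Data.Parity.Base as ℙ using (Parity; 0ℙ; 1ℙ)
import Data.Parity.Properties as ℙ
open import Data.Product.Base using (∃; _×_; _,_)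
open import Data.Sum.Base as Sum using (_⊎_; inj₁; inj₂)
open import Data.Sum.Function.Propositional using (_⊎-↔_)
open import Data.Vec.Base as Vec using (Vec; []; _∷_; head; tail)
import Data.Vec.Functional as F
import Data.Vec.Properties as Vec
open import Function.Base using (_∘_)
open import Function.Bundles using (_↔_; Inverse; mk↔ₛ′)
open import Function.Properties.Inverse using (↔-sym; ↔-trans)
open import Level using (0ℓ)
open import Relation.Nullary.Construct.Add.Supremum using () renaming ([_] to fin)
open import Relation.Nullary.Decidable using (yes; no; ⌊_⌋; _×-dec_)
open import Relation.Nullary.Negation using (¬_; contradiction)

-- Determinants through the exterior algebra

-- Formal sums of terms obey the ring laws only up to their coefficients, and `det` is a bare
-- cofactor expansion. The argument therefore lives in the ring of series under pointwise equality,
-- where 𝐦! [z^𝐦] is a plain value and nothing is ever divided by a factorial; `taylor` carries the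
-- determinant there. Multiplicativity of `det` has to be extracted from cofactor expansion. In the
-- exterior algebra, with vectors acting by left multiplication, that expansion is linearity in the
-- first row followed by reduction modulo one vector, so permutations and their signs never appear.
-- The matrix X is in general not invertible over ℤ. Since X² = n I, however, det X divides the
-- nonzero integer n^n, which can be cancelled from values in ℤ. The factor 2 arises as follows:
-- exchanging the two halves of a splitting multiplies its term in Q · Q′ by the sign of the first
-- bit of the total, so partners agree or cancel according to that bit alone.

module Exterior {c ℓ} (R : CommutativeRing c ℓ) where
  open CommutativeRing R hiding (zero)
  open Determinant rawRing
  open SemiringOps (RawRing.rawSemiring rawRing) using () renaming (_^_ to _↑_; product to ∏)
  open SemiringSum semiring using (sum-cong-≋; sum-remove; sum-replicate-zero; *-distribʳ-sum) renaming (sum to Σ)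
  open import Algebra.Properties.Ring ring using (-‿distribʳ-*; -0#≈0#; -1*x≈-x; -‿+-comm; +-inverseˡ-unique; x+x≈x⇒x≈0)
  open import Algebra.Properties.CommutativeSemigroup +-commutativeSemigroup using () renaming (interchange to +-interchange)
  open import Algebra.Properties.CommutativeSemigroup *-commutativeSemigroup using (x∙yz≈y∙xz)
  open import Relation.Binary.Reasoning.Setoid setoid

  -- The exterior algebra on N generators: a basis element is a subset of the
  -- generators, and v ∧ F is left multiplication by the vector v.
  Λ : ℕ → Set c
  Λ N = Vec Bool N → Carrier

  Row : ℕ → Set c
  Row N = Fin N → Carrier

  infixr 8 _∧_
  infix 4 _≋_

  _≋_ : ∀ {N} → Λ N → Λ N → Set ℓ
  F ≋ G = ∀ bs → F bs ≈ G bs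

  -- Write v = v₀e₀ + v′ and F = F₀ + e₀F₁ with e₀ the zeroth generator. Then v ∧ F = v′F₀ + e₀(v₀F₀
  -- - v′F₁), the minus sign coming from v′e₀ = -e₀v′.
  _∧_ : ∀ {N} → Row N → Λ N → Λ N
  (v ∧ F) []           = 0#
  (v ∧ F) (false ∷ bs) = ((v ∘ suc) ∧ (F ∘ (false ∷_))) bs
  (v ∧ F) (true ∷ bs)  = v zero * F (false ∷ bs) - ((v ∘ suc) ∧ (F ∘ (true ∷_))) bs

  ∧-cong : ∀ {N} {v w : Row N} {F G : Λ N} → (∀ l → v l ≈ w l) → F ≋ G → v ∧ F ≋ w ∧ G
  ∧-cong v≈w F≋G []           = refl
  ∧-cong v≈w F≋G (false ∷ bs) = ∧-cong (v≈w ∘ suc) (F≋G ∘ (false ∷_)) bs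
  ∧-cong v≈w F≋G (true ∷ bs)  =
    +-cong (*-cong (v≈w zero) (F≋G _)) (-‿cong (∧-cong (v≈w ∘ suc) (F≋G ∘ (true ∷_)) bs))

  ∧-congʳ : ∀ {N} (v : Row N) {F G : Λ N} → F ≋ G → v ∧ F ≋ v ∧ G
  ∧-congʳ v = ∧-cong (λ _ → refl)

  ∧-+ˡ : ∀ {N} (v w : Row N) (F : Λ N) bs → ((λ l → v l + w l) ∧ F) bs ≈ (v ∧ F) bs + (w ∧ F) bs
  ∧-+ˡ v w F []           = sym (+-identityˡ 0#)
  ∧-+ˡ v w F (false ∷ bs) = ∧-+ˡ (v ∘ suc) (w ∘ suc) _ bs
  ∧-+ˡ v w F (true ∷ bs)  = begin
    (v zero + w zero) * F (false ∷ bs) - ((λ l → v (suc l) + w (suc l)) ∧ F₁) bs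
      ≈⟨ +-cong (distribʳ _ _ _) (-‿cong (∧-+ˡ (v ∘ suc) (w ∘ suc) F₁ bs)) ⟩
    (v zero * F (false ∷ bs) + w zero * F (false ∷ bs)) - (((v ∘ suc) ∧ F₁) bs + ((w ∘ suc) ∧ F₁) bs)
      ≈⟨ +-congˡ (-‿+-comm _ _) ⟨
    (v zero * F (false ∷ bs) + w zero * F (false ∷ bs)) + (- ((v ∘ suc) ∧ F₁) bs + - ((w ∘ suc) ∧ F₁) bs)
      ≈⟨ +-interchange _ _ _ _ ⟩
    _ ∎
    where F₁ = F ∘ (true ∷_)

  ∧-+ʳ : ∀ {N} (v : Row N) (F G : Λ N) bs → (v ∧ (λ as → F as + G as)) bs ≈ (v ∧ F) bs + (v ∧ G) bs
  ∧-+ʳ v F G []           = sym (+-identityˡ 0#)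
  ∧-+ʳ v F G (false ∷ bs) = ∧-+ʳ (v ∘ suc) _ _ bs
  ∧-+ʳ v F G (true ∷ bs)  = begin
    v zero * (F (false ∷ bs) + G (false ∷ bs)) - ((v ∘ suc) ∧ (λ as → F₁ as + G₁ as)) bs
      ≈⟨ +-cong (distribˡ _ _ _) (-‿cong (∧-+ʳ (v ∘ suc) F₁ G₁ bs)) ⟩
    (v zero * F (false ∷ bs) + v zero * G (false ∷ bs)) - (((v ∘ suc) ∧ F₁) bs + ((v ∘ suc) ∧ G₁) bs)
      ≈⟨ +-congˡ (-‿+-comm _ _) ⟨
    (v zero * F (false ∷ bs) + v zero * G (false ∷ bs)) + (- ((v ∘ suc) ∧ F₁) bs + - ((v ∘ suc) ∧ G₁) bs)
      ≈⟨ +-interchange _ _ _ _ ⟩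
    _ ∎
    where
    F₁ = F ∘ (true ∷_)
    G₁ = G ∘ (true ∷_)

  ∧-*ˡ : ∀ {N} a (v : Row N) (F : Λ N) bs → ((λ l → a * v l) ∧ F) bs ≈ a * (v ∧ F) bs
  ∧-*ˡ a v F []           = sym (zeroʳ a)
  ∧-*ˡ a v F (false ∷ bs) = ∧-*ˡ a (v ∘ suc) _ bs
  ∧-*ˡ a v F (true ∷ bs)  = begin
    (a * v zero) * F (false ∷ bs) - ((λ l → a * v (suc l)) ∧ F₁) bs
      ≈⟨ +-cong (*-assoc _ _ _) (-‿cong (∧-*ˡ a (v ∘ suc) F₁ bs)) ⟩
    a * (v zero * F (false ∷ bs)) - a * ((v ∘ suc) ∧ F₁) bs
      ≈⟨ +-congˡ (-‿distribʳ-* _ _) ⟩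
    a * (v zero * F (false ∷ bs)) + a * - ((v ∘ suc) ∧ F₁) bs
      ≈⟨ distribˡ _ _ _ ⟨
    _ ∎
    where F₁ = F ∘ (true ∷_)

  ∧-*ʳ : ∀ {N} a (v : Row N) (F : Λ N) bs → (v ∧ (λ as → a * F as)) bs ≈ a * (v ∧ F) bs
  ∧-*ʳ a v F []           = sym (zeroʳ a)
  ∧-*ʳ a v F (false ∷ bs) = ∧-*ʳ a (v ∘ suc) _ bs
  ∧-*ʳ a v F (true ∷ bs)  = begin
    v zero * (a * F (false ∷ bs)) - ((v ∘ suc) ∧ (λ as → a * F₁ as)) bs
      ≈⟨ +-cong (x∙yz≈y∙xz _ _ _) (-‿cong (∧-*ʳ a (v ∘ suc) F₁ bs)) ⟩
    a * (v zero * F (false ∷ bs)) - a * ((v ∘ suc) ∧ F₁) bs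
      ≈⟨ +-congˡ (-‿distribʳ-* _ _) ⟩
    a * (v zero * F (false ∷ bs)) + a * - ((v ∘ suc) ∧ F₁) bs
      ≈⟨ distribˡ _ _ _ ⟨
    _ ∎
    where F₁ = F ∘ (true ∷_)

  ∧-0ˡ : ∀ {N} (F : Λ N) bs → ((λ _ → 0#) ∧ F) bs ≈ 0#
  ∧-0ˡ F bs = x+x≈x⇒x≈0 _ (trans (sym (∧-+ˡ _ _ F bs)) (∧-cong (λ _ → +-identityˡ 0#) (λ _ → refl) bs))

  ∧-Σ : ∀ {N n} (X : Fin n → Carrier) (G : Fin n → Row N) (F : Λ N) bs →
        ((λ l → Σ (λ k → X k * G k l)) ∧ F) bs ≈ Σ (λ k → X k * (G k ∧ F) bs)
  ∧-Σ {n = zero}  X G F bs = ∧-0ˡ F bs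
  ∧-Σ {n = suc n} X G F bs =
    trans (∧-+ˡ _ _ F bs) (+-cong (∧-*ˡ (X zero) (G zero) F bs) (∧-Σ (X ∘ suc) (G ∘ suc) F bs))

  -- In the component of the zeroth generator the two terms v₀ · v′F₀ cancel and leave v′ ∧ v′ ∧ F₁,
  -- which has one generator fewer.
  ∧-square : ∀ {N} (v : Row N) (F : Λ N) bs → (v ∧ v ∧ F) bs ≈ 0#
  ∧-square v F []           = refl
  ∧-square v F (false ∷ bs) = ∧-square (v ∘ suc) _ bs
  ∧-square v F (true ∷ bs)  = begin
    v zero * (v′ ∧ F₀) bs - (v′ ∧ (λ as → v zero * F₀ as - (v′ ∧ F₁) as)) bs
      ≈⟨ +-congˡ (-‿cong (∧-+ʳ v′ (λ as → v zero * F₀ as) (λ as → - (v′ ∧ F₁) as) bs)) ⟩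
    v zero * (v′ ∧ F₀) bs - ((v′ ∧ (λ as → v zero * F₀ as)) bs + (v′ ∧ (λ as → - (v′ ∧ F₁) as)) bs)
      ≈⟨ +-congˡ (-‿cong (+-cong (∧-*ʳ (v zero) v′ F₀ bs)
           (trans (∧-congʳ v′ (λ as → sym (-1*x≈-x _)) bs) (∧-*ʳ (- 1#) v′ (v′ ∧ F₁) bs)))) ⟩
    v zero * (v′ ∧ F₀) bs - (v zero * (v′ ∧ F₀) bs + - 1# * (v′ ∧ v′ ∧ F₁) bs)
      ≈⟨ +-congˡ (-‿cong (+-congˡ (trans (*-congˡ (∧-square v′ F₁ bs)) (zeroʳ _)))) ⟩
    v zero * (v′ ∧ F₀) bs - (v zero * (v′ ∧ F₀) bs + 0#)
      ≈⟨ +-congˡ (-‿cong (+-identityʳ _)) ⟩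
    v zero * (v′ ∧ F₀) bs - v zero * (v′ ∧ F₀) bs
      ≈⟨ -‿inverseʳ _ ⟩
    0# ∎
    where
    v′ = v ∘ suc
    F₀ = F ∘ (false ∷_)
    F₁ = F ∘ (true ∷_)

  -- Polarisation: expand the square of v + w. Squares come first because anticommutativity alone
  -- would not yield them in a ring where 2 is a zero divisor.
  ∧-anticomm : ∀ {N} (v w : Row N) (F : Λ N) bs → (v ∧ w ∧ F) bs ≈ - (w ∧ v ∧ F) bs
  ∧-anticomm v w F bs = +-inverseˡ-unique _ _ (begin
    (v ∧ w ∧ F) bs + (w ∧ v ∧ F) bs
      ≈⟨ +-cong (+-identityˡ _) (+-identityʳ _) ⟨
    (0# + (v ∧ w ∧ F) bs) + ((w ∧ v ∧ F) bs + 0#)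
      ≈⟨ +-cong (+-congʳ (∧-square v F bs)) (+-congˡ (∧-square w F bs)) ⟨
    ((v ∧ v ∧ F) bs + (v ∧ w ∧ F) bs) + ((w ∧ v ∧ F) bs + (w ∧ w ∧ F) bs)
      ≈⟨ +-cong (expand v) (expand w) ⟨
    (v ∧ u ∧ F) bs + (w ∧ u ∧ F) bs
      ≈⟨ ∧-+ˡ v w (u ∧ F) bs ⟨
    (u ∧ u ∧ F) bs
      ≈⟨ ∧-square u F bs ⟩
    0# ∎)
    where
    u = λ l → v l + w l
    expand : ∀ x → (x ∧ u ∧ F) bs ≈ (x ∧ v ∧ F) bs + (x ∧ w ∧ F) bs
    expand x = trans (∧-congʳ x (∧-+ˡ v w F) bs) (∧-+ʳ x (v ∧ F) (w ∧ F) bs)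

  ⋀ : ∀ {n N} → (Fin n → Row N) → Λ N → Λ N
  ⋀ {zero}  A F = F
  ⋀ {suc n} A F = A zero ∧ ⋀ (A ∘ suc) F

  ⋀-cong : ∀ {n N} {A B : Fin n → Row N} → (∀ i l → A i l ≈ B i l) → ∀ F → ⋀ A F ≋ ⋀ B F
  ⋀-cong {zero}  A≈B F bs = refl
  ⋀-cong {suc n} A≈B F    = ∧-cong (A≈B zero) (⋀-cong (A≈B ∘ suc) F)

  -- Anticommuting g past each factor, its multiples there are killed by g ∧ g = 0.
  ∧⋀-absorb : ∀ {n N} (g : Row N) (A B : Fin n → Row N) (a : Fin n → Carrier) →
              (∀ i l → A i l ≈ B i l + a i * g l) → ∀ F → g ∧ ⋀ A F ≋ g ∧ ⋀ B F
  ∧⋀-absorb {zero}  g A B a eq F bs = refl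
  ∧⋀-absorb {suc n} g A B a eq F bs = begin
    (g ∧ A zero ∧ Z) bs
      ≈⟨ ∧-congʳ g (λ cs → trans (∧-cong (eq zero) (λ _ → refl) cs) (∧-+ˡ (B zero) _ Z cs)) bs ⟩
    (g ∧ (λ cs → (B zero ∧ Z) cs + ((λ l → a zero * g l) ∧ Z) cs)) bs
      ≈⟨ ∧-+ʳ g _ _ bs ⟩
    (g ∧ B zero ∧ Z) bs + (g ∧ (λ l → a zero * g l) ∧ Z) bs
      ≈⟨ +-congˡ (trans (∧-congʳ g (∧-*ˡ (a zero) g Z) bs) (∧-*ʳ (a zero) g (g ∧ Z) bs)) ⟩
    (g ∧ B zero ∧ Z) bs + a zero * (g ∧ g ∧ Z) bs
      ≈⟨ +-congˡ (trans (*-congˡ (∧-square g Z bs)) (zeroʳ _)) ⟩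
    (g ∧ B zero ∧ Z) bs + 0#
      ≈⟨ +-identityʳ _ ⟩
    (g ∧ B zero ∧ Z) bs
      ≈⟨ ∧-anticomm g (B zero) Z bs ⟩
    - (B zero ∧ g ∧ Z) bs
      ≈⟨ -‿cong (∧-congʳ (B zero) (∧⋀-absorb g (A ∘ suc) (B ∘ suc) (a ∘ suc) (eq ∘ suc) F) bs) ⟩
    - (B zero ∧ g ∧ ⋀ (B ∘ suc) F) bs
      ≈⟨ ∧-anticomm g (B zero) _ bs ⟨
    (g ∧ B zero ∧ ⋀ (B ∘ suc) F) bs ∎
    where Z = ⋀ (A ∘ suc) F

  -- Moving `G j` back to its own place passes j rows; this is the origin of the cofactor sign.
  ∧⋀-punchIn : ∀ {n N} (G : Fin (suc n) → Row N) j F bs →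
               (G j ∧ ⋀ (G ∘ punchIn j) F) bs ≈ ((- 1#) ↑ toℕ j) * ⋀ G F bs
  ∧⋀-punchIn         G zero    F bs = sym (*-identityˡ _)
  ∧⋀-punchIn {suc n} G (suc j) F bs = begin
    (G (suc j) ∧ G zero ∧ Y) bs
      ≈⟨ ∧-anticomm (G (suc j)) (G zero) Y bs ⟩
    - (G zero ∧ G (suc j) ∧ Y) bs
      ≈⟨ -‿cong (∧-congʳ (G zero) (∧⋀-punchIn (G ∘ suc) j F) bs) ⟩
    - (G zero ∧ (λ as → ((- 1#) ↑ toℕ j) * ⋀ (G ∘ suc) F as)) bs
      ≈⟨ -‿cong (∧-*ʳ _ (G zero) _ bs) ⟩
    - (((- 1#) ↑ toℕ j) * ⋀ G F bs)
      ≈⟨ -1*x≈-x _ ⟨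
    - 1# * (((- 1#) ↑ toℕ j) * ⋀ G F bs)
      ≈⟨ *-assoc _ _ _ ⟨
    ((- 1#) ↑ toℕ (suc j)) * ⋀ G F bs ∎
    where Y = ⋀ ((G ∘ suc) ∘ punchIn j) F

  infixl 7 _⊡_

  _⊡_ : ∀ {n m N} → (Fin m → Row n) → (Fin n → Row N) → Fin m → Row N
  (X ⊡ G) i l = Σ (λ k → X i k * G k l)

  -- Linearity in the first row gives a sum over j. Behind the factor `G j` the remaining rows
  -- matter only modulo `G j`, which deletes column j of X and leaves the minor. The rows G are
  -- arbitrary so that `δ` identifies `det` as a top coefficient, while a second matrix gives
  -- multiplicativity.
  ⋀-⊡ : ∀ {n N} (X : Matrix n) (G : Fin n → Row N) F bs → ⋀ (X ⊡ G) F bs ≈ det X * ⋀ G F bs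
  ⋀-⊡ {zero}  X G F bs = sym (*-identityˡ _)
  ⋀-⊡ {suc n} X G F bs = begin
    ((X ⊡ G) zero ∧ W) bs
      ≈⟨ ∧-Σ (X zero) G W bs ⟩
    Σ (λ j → X zero j * (G j ∧ W) bs)
      ≈⟨ sum-cong-≋ term ⟩
    Σ (λ j → (((- 1#) ↑ toℕ j) * (X zero j * det (minor X j))) * ⋀ G F bs)
      ≈⟨ *-distribʳ-sum _ (λ j → ((- 1#) ↑ toℕ j) * (X zero j * det (minor X j))) ⟨
    det X * ⋀ G F bs ∎
    where
    W = ⋀ ((X ⊡ G) ∘ suc) F
    term : ∀ j → X zero j * (G j ∧ W) bs ≈ (((- 1#) ↑ toℕ j) * (X zero j * det (minor X j))) * ⋀ G F bs
    term j = begin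
      X zero j * (G j ∧ W) bs
        ≈⟨ *-congˡ (∧⋀-absorb (G j) _ (minor X j ⊡ (G ∘ punchIn j)) (λ i → X (suc i) j)
             (λ i l → trans (sum-remove {i = j} (λ k → X (suc i) k * G k l)) (+-comm _ _)) F bs) ⟩
      X zero j * (G j ∧ ⋀ (minor X j ⊡ (G ∘ punchIn j)) F) bs
        ≈⟨ *-congˡ (trans (∧-congʳ (G j) (⋀-⊡ (minor X j) (G ∘ punchIn j) F) bs) (∧-*ʳ _ (G j) _ bs)) ⟩
      X zero j * (det (minor X j) * (G j ∧ ⋀ (G ∘ punchIn j) F) bs)
        ≈⟨ *-congˡ (*-congˡ (∧⋀-punchIn G j F bs)) ⟩
      X zero j * (det (minor X j) * (((- 1#) ↑ toℕ j) * ⋀ G F bs))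
        ≈⟨ *-assoc _ _ _ ⟨
      X zero j * det (minor X j) * (((- 1#) ↑ toℕ j) * ⋀ G F bs)
        ≈⟨ x∙yz≈y∙xz _ _ _ ⟩
      ((- 1#) ↑ toℕ j) * (X zero j * det (minor X j) * ⋀ G F bs)
        ≈⟨ *-assoc _ _ _ ⟨
      _ ∎

  𝟙 : ∀ {N} → Λ N
  𝟙 []           = 1#
  𝟙 (false ∷ bs) = 𝟙 bs
  𝟙 (true ∷ bs)  = 0#

  top : ∀ N → Vec Bool N
  top N = Vec.replicate N true

  δ : ∀ {n} → Matrix n
  δ zero    zero    = 1#
  δ zero    (suc j) = 0#
  δ (suc i) zero    = 0#
  δ (suc i) (suc j) = δ i j

  -- Rows whose zeroth entry vanishes act on the part of F free of the zeroth generator.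
  ⋀-shift : ∀ {n N} (A : Fin n → Row (suc N)) → (∀ i → A i zero ≈ 0#) → ∀ F bs →
            ⋀ A F (false ∷ bs) ≈ ⋀ (λ i → A i ∘ suc) (F ∘ (false ∷_)) bs
  ⋀-shift {zero}  A A₀ F bs = refl
  ⋀-shift {suc n} A A₀ F bs = ∧-congʳ (A zero ∘ suc) (⋀-shift (A ∘ suc) (A₀ ∘ suc) F) bs

  ⋀-δ : ∀ n → ⋀ (δ {n}) 𝟙 (top n) ≈ 1#
  ⋀-δ zero    = refl
  ⋀-δ (suc n) = begin
    1# * W (false ∷ top n) - ((λ _ → 0#) ∧ (W ∘ (true ∷_))) (top n)
      ≈⟨ +-cong (*-identityˡ _) (-‿cong (∧-0ˡ _ (top n))) ⟩
    W (false ∷ top n) - 0#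
      ≈⟨ trans (+-congˡ -0#≈0#) (+-identityʳ _) ⟩
    W (false ∷ top n)
      ≈⟨ ⋀-shift {n} (δ ∘ suc) (λ _ → refl) 𝟙 (top n) ⟩
    ⋀ (δ {n}) 𝟙 (top n)
      ≈⟨ ⋀-δ n ⟩
    1# ∎
    where
    W : Λ (suc n)
    W = ⋀ (δ {suc n} ∘ suc) 𝟙

  Σ-δ : ∀ {n} (f : Fin n → Carrier) j → Σ (λ k → f k * δ k j) ≈ f j
  Σ-δ {suc n} f zero = begin
    f zero * 1# + Σ (λ k → f (suc k) * 0#)
      ≈⟨ +-cong (*-identityʳ _) (trans (sum-cong-≋ (λ k → zeroʳ (f (suc k)))) (sum-replicate-zero n)) ⟩
    f zero + 0#
      ≈⟨ +-identityʳ _ ⟩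
    f zero ∎
  Σ-δ {suc n} f (suc j) = trans (+-cong (zeroʳ _) (Σ-δ (f ∘ suc) j)) (+-identityˡ _)

  -- Through this form `det` inherits congruence and homogeneity in its rows from `_∧_`, with no
  -- further induction over minors.
  det≈⋀ : ∀ {n} (X : Matrix n) → det X ≈ ⋀ X 𝟙 (top _)
  det≈⋀ {n} X = begin
    det X                ≈⟨ *-identityʳ _ ⟨
    det X * 1#           ≈⟨ *-congˡ (⋀-δ n) ⟨
    det X * ⋀ (δ {n}) 𝟙 (top _)    ≈⟨ ⋀-⊡ X δ 𝟙 (top _) ⟨
    ⋀ (X ⊡ δ) 𝟙 (top _)      ≈⟨ ⋀-cong (λ i → Σ-δ (X i)) 𝟙 (top _) ⟩
    ⋀ X 𝟙 (top _)            ∎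

  det-⊡ : ∀ {n} (X Y : Matrix n) → det (X ⊡ Y) ≈ det X * det Y
  det-⊡ X Y = trans (det≈⋀ (X ⊡ Y)) (trans (⋀-⊡ X Y 𝟙 (top _)) (*-congˡ (sym (det≈⋀ Y))))

  det-cong : ∀ {n} {X Y : Matrix n} → (∀ i j → X i j ≈ Y i j) → det X ≈ det Y
  det-cong {X = X} {Y} X≈Y = trans (det≈⋀ X) (trans (⋀-cong X≈Y 𝟙 (top _)) (sym (det≈⋀ Y)))

  det-δ : ∀ n → det (δ {n}) ≈ 1#
  det-δ n = trans (det≈⋀ (δ {n})) (⋀-δ n)

  ⋀-scale : ∀ {n N} (a : Fin n → Carrier) (A : Fin n → Row N) F bs →
            ⋀ (λ i l → a i * A i l) F bs ≈ ∏ a * ⋀ A F bs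
  ⋀-scale {zero}  a A F bs = sym (*-identityˡ _)
  ⋀-scale {suc n} a A F bs = begin
    ((λ l → a zero * A zero l) ∧ ⋀ (λ i l → a (suc i) * A (suc i) l) F) bs
      ≈⟨ ∧-*ˡ (a zero) (A zero) _ bs ⟩
    a zero * (A zero ∧ ⋀ (λ i l → a (suc i) * A (suc i) l) F) bs
      ≈⟨ *-congˡ (trans (∧-congʳ (A zero) (⋀-scale (a ∘ suc) (A ∘ suc) F) bs) (∧-*ʳ _ (A zero) _ bs)) ⟩
    a zero * (∏ (a ∘ suc) * ⋀ A F bs)
      ≈⟨ *-assoc _ _ _ ⟨
    _ ∎

  det-scale : ∀ {n} (a : Fin n → Carrier) (X : Matrix n) → det (λ i j → a i * X i j) ≈ ∏ a * det X
  det-scale a X = trans (det≈⋀ (λ i j → a i * X i j)) (trans (⋀-scale a X 𝟙 (top _)) (*-congˡ (sym (det≈⋀ X))))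

open import Algebra.Properties.CommutativeSemigroup ℙ.+-commutativeSemigroup using () renaming (interchange to +-interchange)
open import Algebra.Properties.CommutativeSemigroup ℤ.*-commutativeSemigroup using () renaming (interchange to *ℤ-interchange)
open import Algebra.Properties.CommutativeSemigroup ℤ.+-commutativeSemigroup using () renaming (interchange to +ℤ-interchange)
open import Relation.Binary.PropositionalEquality using (_≡_; _≢_; _≗_; refl; sym; trans; cong; cong₂; subst; module ≡-Reasoning)

-- Exponential generating functions

-- Exponential generating functions over the alphabet A: F xs is the value at
-- the origin of the iterated derivative ∂_{x₁} ⋯ ∂_{xₖ} F, and ⊛ obeys Leibniz' rule.
Series : Set → Set
Series A = List A → ℤ

module _ {A : Set} where

  infixl 7 _⊛_
  infixl 6 _⊞_

  ∂ : A → Series A → Series A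
  ∂ x F = F ∘ (x ∷_)

  _⊞_ : Series A → Series A → Series A
  (F ⊞ G) xs = F xs ℤ.+ G xs

  ⊟_ : Series A → Series A
  (⊟ F) xs = ℤ.- F xs

  𝟘 : Series A
  𝟘 _ = 0ℤ

  𝟏 : Series A
  𝟏 []      = 1ℤ
  𝟏 (_ ∷ _) = 0ℤ

  -- Unfolded, `(F ⊛ G) xs` adds up F ys · G zs over all ways of distributing the positions of xs
  -- between two sublists ys and zs.
  _⊛_ : Series A → Series A → Series A
  (F ⊛ G) []       = F [] ℤ.* G []
  (F ⊛ G) (x ∷ xs) = (∂ x F ⊛ G) xs ℤ.+ (F ⊛ ∂ x G) xs

  ⊛-cong : ∀ {F F′ G G′} → F ≗ F′ → G ≗ G′ → F ⊛ G ≗ F′ ⊛ G′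
  ⊛-cong p q []       = cong₂ ℤ._*_ (p []) (q [])
  ⊛-cong p q (x ∷ xs) = cong₂ ℤ._+_ (⊛-cong (p ∘ (x ∷_)) q xs) (⊛-cong p (q ∘ (x ∷_)) xs)

  ⊛-comm : ∀ F G → F ⊛ G ≗ G ⊛ F
  ⊛-comm F G []       = ℤ.*-comm (F []) (G [])
  ⊛-comm F G (x ∷ xs) = begin
    (∂ x F ⊛ G) xs ℤ.+ (F ⊛ ∂ x G) xs   ≡⟨ cong₂ ℤ._+_ (⊛-comm (∂ x F) G xs) (⊛-comm F (∂ x G) xs) ⟩
    (G ⊛ ∂ x F) xs ℤ.+ (∂ x G ⊛ F) xs   ≡⟨ ℤ.+-comm ((G ⊛ ∂ x F) xs) _ ⟩
    (∂ x G ⊛ F) xs ℤ.+ (G ⊛ ∂ x F) xs   ∎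
    where open ≡-Reasoning

  ⊛-distribʳ : ∀ H F G → (F ⊞ G) ⊛ H ≗ (F ⊛ H) ⊞ (G ⊛ H)
  ⊛-distribʳ H F G []       = ℤ.*-distribʳ-+ (H []) (F []) (G [])
  ⊛-distribʳ H F G (x ∷ xs) = begin
    ((∂ x F ⊞ ∂ x G) ⊛ H) xs ℤ.+ ((F ⊞ G) ⊛ ∂ x H) xs
      ≡⟨ cong₂ ℤ._+_ (⊛-distribʳ H (∂ x F) (∂ x G) xs) (⊛-distribʳ (∂ x H) F G xs) ⟩
    ((∂ x F ⊛ H) xs ℤ.+ (∂ x G ⊛ H) xs) ℤ.+ ((F ⊛ ∂ x H) xs ℤ.+ (G ⊛ ∂ x H) xs)
      ≡⟨ +ℤ-interchange ((∂ x F ⊛ H) xs) _ _ _ ⟩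
    _ ∎
    where open ≡-Reasoning

  ⊛-distribˡ : ∀ H F G → H ⊛ (F ⊞ G) ≗ (H ⊛ F) ⊞ (H ⊛ G)
  ⊛-distribˡ H F G xs =
    trans (⊛-comm H (F ⊞ G) xs) (trans (⊛-distribʳ H F G xs) (cong₂ ℤ._+_ (⊛-comm F H xs) (⊛-comm G H xs)))

  ⊛-assoc : ∀ F G H → (F ⊛ G) ⊛ H ≗ F ⊛ (G ⊛ H)
  ⊛-assoc F G H []       = ℤ.*-assoc (F []) (G []) (H [])
  ⊛-assoc F G H (x ∷ xs) = begin
    (((∂ x F ⊛ G) ⊞ (F ⊛ ∂ x G)) ⊛ H) xs ℤ.+ ((F ⊛ G) ⊛ ∂ x H) xs
      ≡⟨ cong (ℤ._+ ((F ⊛ G) ⊛ ∂ x H) xs) (⊛-distribʳ H (∂ x F ⊛ G) (F ⊛ ∂ x G) xs) ⟩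
    ((∂ x F ⊛ G) ⊛ H) xs ℤ.+ ((F ⊛ ∂ x G) ⊛ H) xs ℤ.+ ((F ⊛ G) ⊛ ∂ x H) xs
      ≡⟨ cong₂ ℤ._+_ (cong₂ ℤ._+_ (⊛-assoc (∂ x F) G H xs) (⊛-assoc F (∂ x G) H xs)) (⊛-assoc F G (∂ x H) xs) ⟩
    (∂ x F ⊛ (G ⊛ H)) xs ℤ.+ (F ⊛ (∂ x G ⊛ H)) xs ℤ.+ (F ⊛ (G ⊛ ∂ x H)) xs
      ≡⟨ ℤ.+-assoc ((∂ x F ⊛ (G ⊛ H)) xs) _ _ ⟩
    (∂ x F ⊛ (G ⊛ H)) xs ℤ.+ ((F ⊛ (∂ x G ⊛ H)) xs ℤ.+ (F ⊛ (G ⊛ ∂ x H)) xs)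
      ≡⟨ cong (ℤ._+_ ((∂ x F ⊛ (G ⊛ H)) xs)) (⊛-distribˡ F (∂ x G ⊛ H) (G ⊛ ∂ x H) xs) ⟨
    _ ∎
    where open ≡-Reasoning

  ⊛-zeroˡ : ∀ F → 𝟘 ⊛ F ≗ 𝟘
  ⊛-zeroˡ F []       = ℤ.*-zeroˡ (F [])
  ⊛-zeroˡ F (x ∷ xs) = cong₂ ℤ._+_ (⊛-zeroˡ F xs) (⊛-zeroˡ (∂ x F) xs)

  ⊛-identityˡ : ∀ F → 𝟏 ⊛ F ≗ F
  ⊛-identityˡ F []       = ℤ.*-identityˡ (F [])
  ⊛-identityˡ F (x ∷ xs) = trans (cong₂ ℤ._+_ (⊛-zeroˡ F xs) (⊛-identityˡ (∂ x F) xs)) (ℤ.+-identityˡ _)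

  ⊛-scaleˡ : ∀ c F G xs → ((λ ys → c ℤ.* F ys) ⊛ G) xs ≡ c ℤ.* (F ⊛ G) xs
  ⊛-scaleˡ c F G []       = ℤ.*-assoc c (F []) (G [])
  ⊛-scaleˡ c F G (x ∷ xs) = trans (cong₂ ℤ._+_ (⊛-scaleˡ c (∂ x F) G xs) (⊛-scaleˡ c F (∂ x G) xs))
                                  (sym (ℤ.*-distribˡ-+ c _ _))

  ⊛-scaleʳ : ∀ c F G xs → (F ⊛ (λ ys → c ℤ.* G ys)) xs ≡ c ℤ.* (F ⊛ G) xs
  ⊛-scaleʳ c F G xs = trans (⊛-comm F _ xs) (trans (⊛-scaleˡ c G F xs) (cong (c ℤ.*_) (⊛-comm G F xs)))

  ⊛-isCommutativeRing : IsCommutativeRing _≗_ _⊞_ _⊛_ ⊟_ 𝟘 𝟏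
  ⊛-isCommutativeRing = record
    { isRing = record
      { +-isAbelianGroup = record
        { isGroup = record
          { isMonoid = record
            { isSemigroup = record
              { isMagma = record
                { isEquivalence = record
                  { refl  = λ _ → refl
                  ; sym   = λ p xs → sym (p xs)
                  ; trans = λ p q xs → trans (p xs) (q xs)
                  }
                ; ∙-cong = λ p q xs → cong₂ ℤ._+_ (p xs) (q xs)
                }
              ; assoc = λ F G H xs → ℤ.+-assoc (F xs) (G xs) (H xs)
              }
            ; identity = (λ F xs → ℤ.+-identityˡ (F xs)) , (λ F xs → ℤ.+-identityʳ (F xs))
            }
          ; inverse = (λ F xs → ℤ.+-inverseˡ (F xs)) , (λ F xs → ℤ.+-inverseʳ (F xs))
          ; ⁻¹-cong = λ p xs → cong ℤ.-_ (p xs)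
          }
        ; comm = λ F G xs → ℤ.+-comm (F xs) (G xs)
        }
      ; *-cong = ⊛-cong
      ; *-assoc = ⊛-assoc
      ; *-identity = ⊛-identityˡ , λ F xs → trans (⊛-comm F 𝟏 xs) (⊛-identityˡ F xs)
      ; distrib = ⊛-distribˡ , ⊛-distribʳ
      }
    ; *-comm = ⊛-comm
    }

  twistFactor : (A → ℤ) → Series A
  twistFactor s []       = 1ℤ
  twistFactor s (x ∷ xs) = s x ℤ.* twistFactor s xs

  -- The substitution of s(x) · zₓ for zₓ, which is why it respects products.
  twist : (A → ℤ) → Series A → Series A
  twist s F xs = twistFactor s xs ℤ.* F xs

  twist-⊛ : ∀ s F G → twist s (F ⊛ G) ≗ twist s F ⊛ twist s G
  twist-⊛ s F G []       = trans (ℤ.*-identityˡ _) (sym (cong₂ ℤ._*_ (ℤ.*-identityˡ (F [])) (ℤ.*-identityˡ (G []))))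
  twist-⊛ s F G (x ∷ xs) = begin
    s x ℤ.* S ℤ.* ((∂ x F ⊛ G) xs ℤ.+ (F ⊛ ∂ x G) xs)
      ≡⟨ ℤ.*-assoc (s x) S _ ⟩
    s x ℤ.* (S ℤ.* ((∂ x F ⊛ G) xs ℤ.+ (F ⊛ ∂ x G) xs))
      ≡⟨ cong (s x ℤ.*_) (ℤ.*-distribˡ-+ S _ _) ⟩
    s x ℤ.* (S ℤ.* (∂ x F ⊛ G) xs ℤ.+ S ℤ.* (F ⊛ ∂ x G) xs)
      ≡⟨ ℤ.*-distribˡ-+ (s x) _ _ ⟩
    s x ℤ.* (S ℤ.* (∂ x F ⊛ G) xs) ℤ.+ s x ℤ.* (S ℤ.* (F ⊛ ∂ x G) xs)
      ≡⟨ cong₂ (λ a b → s x ℤ.* a ℤ.+ s x ℤ.* b) (twist-⊛ s (∂ x F) G xs) (twist-⊛ s F (∂ x G) xs) ⟩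
    s x ℤ.* (twist s (∂ x F) ⊛ twist s G) xs ℤ.+ s x ℤ.* (twist s F ⊛ twist s (∂ x G)) xs
      ≡⟨ cong₂ ℤ._+_ (⊛-scaleˡ (s x) _ (twist s G) xs) (⊛-scaleʳ (s x) (twist s F) _ xs) ⟨
    ((λ ys → s x ℤ.* twist s (∂ x F) ys) ⊛ twist s G) xs ℤ.+ (twist s F ⊛ (λ ys → s x ℤ.* twist s (∂ x G) ys)) xs
      ≡⟨ cong₂ ℤ._+_ (⊛-cong {G = twist s G} (λ ys → sym (ℤ.*-assoc (s x) _ (F (x ∷ ys)))) (λ _ → refl) xs)
                     (⊛-cong {F = twist s F} (λ _ → refl) (λ ys → sym (ℤ.*-assoc (s x) _ (G (x ∷ ys)))) xs) ⟩
    _ ∎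
    where
    open ≡-Reasoning
    S = twistFactor s xs

  twist-𝟏 : ∀ s → twist s 𝟏 ≗ 𝟏
  twist-𝟏 s []       = refl
  twist-𝟏 s (x ∷ xs) = ℤ.*-zeroʳ (twistFactor s (x ∷ xs))

  twistFactor-square : ∀ s → (∀ x → s x ℤ.* s x ≡ 1ℤ) → ∀ xs → twistFactor s xs ℤ.* twistFactor s xs ≡ 1ℤ
  twistFactor-square s s² []       = refl
  twistFactor-square s s² (x ∷ xs) =
    trans (*ℤ-interchange (s x) _ (s x) _) (cong₂ ℤ._*_ (s² x) (twistFactor-square s s² xs))

  twist-involutive : ∀ s → (∀ x → s x ℤ.* s x ≡ 1ℤ) → ∀ F → twist s (twist s F) ≗ F
  twist-involutive s s² F xs = trans (sym (ℤ.*-assoc (twistFactor s xs) _ (F xs)))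
    (trans (cong (ℤ._* F xs) (twistFactor-square s s² xs)) (ℤ.*-identityˡ (F xs)))

  -- The two halves of Leibniz' rule for V ⊛ twist s V are exchanged by the twist.
  twist-Leibniz : ∀ s → (∀ x → s x ℤ.* s x ≡ 1ℤ) → ∀ V x xs →
                  (V ⊛ ∂ x (twist s V)) xs ≡ twistFactor s (x ∷ xs) ℤ.* (∂ x V ⊛ twist s V) xs
  twist-Leibniz s s² V x xs = begin
    (V ⊛ ∂ x (twist s V)) xs
      ≡⟨ ⊛-cong {F = V} (λ _ → refl) (λ ys → ℤ.*-assoc (s x) _ (V (x ∷ ys))) xs ⟩
    (V ⊛ (λ ys → s x ℤ.* twist s (∂ x V) ys)) xs
      ≡⟨ ⊛-scaleʳ (s x) V _ xs ⟩
    s x ℤ.* (V ⊛ twist s (∂ x V)) xs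
      ≡⟨ cong (s x ℤ.*_) (⊛-cong {G = twist s (∂ x V)} (λ ys → sym (twist-involutive s s² V ys)) (λ _ → refl) xs) ⟩
    s x ℤ.* (twist s (twist s V) ⊛ twist s (∂ x V)) xs
      ≡⟨ cong (s x ℤ.*_) (twist-⊛ s (twist s V) (∂ x V) xs) ⟨
    s x ℤ.* (twistFactor s xs ℤ.* (twist s V ⊛ ∂ x V) xs)
      ≡⟨ ℤ.*-assoc (s x) _ _ ⟨
    twistFactor s (x ∷ xs) ℤ.* (twist s V ⊛ ∂ x V) xs
      ≡⟨ cong (twistFactor s (x ∷ xs) ℤ.*_) (⊛-comm (twist s V) (∂ x V) xs) ⟩
    _ ∎
    where open ≡-Reasoning

Series-commutativeRing : Set → CommutativeRing 0ℓ 0ℓ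
Series-commutativeRing A = record { isCommutativeRing = ⊛-isCommutativeRing {A} }

module _ {A B : Set} (h : B → A) where

  -- The substitution of the sum of all z_b with h(b) = a for z_a: by the chain rule,
  -- differentiating along b afterwards is differentiating along h(b) before.
  pull : Series A → Series B
  pull F = F ∘ map h

  pull-⊛ : ∀ F G → pull (F ⊛ G) ≗ pull F ⊛ pull G
  pull-⊛ F G []       = refl
  pull-⊛ F G (x ∷ xs) = cong₂ ℤ._+_ (pull-⊛ (∂ (h x) F) G xs) (pull-⊛ F (∂ (h x) G) xs)

  pull-𝟏 : pull 𝟏 ≗ 𝟏
  pull-𝟏 []      = refl
  pull-𝟏 (_ ∷ _) = refl

-- Products of indicator functions modulo 2

⊕-assoc : ∀ {r} (x y z : H r) → (x ⊕ y) ⊕ z ≡ x ⊕ (y ⊕ z)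
⊕-assoc = Vec.zipWith-assoc ℙ.+-assoc

⊕-comm : ∀ {r} (x y : H r) → x ⊕ y ≡ y ⊕ x
⊕-comm = Vec.zipWith-comm ℙ.+-comm

⊕-identityˡ : ∀ {r} (x : H r) → 𝟎 ⊕ x ≡ x
⊕-identityˡ = Vec.zipWith-identityˡ ℙ.+-identityˡ

⊕-self : ∀ {r} (x : H r) → x ⊕ x ≡ 𝟎
⊕-self []      = refl
⊕-self (p ∷ x) = cong₂ _∷_ (ℙ.p+p≡0ℙ p) (⊕-self x)

⊕-insertʳ : ∀ {r} (x u v : H r) {t} → u ⊕ v ≡ t → u ⊕ (x ⊕ v) ≡ x ⊕ t
⊕-insertʳ x u v {t} q = begin
  u ⊕ (x ⊕ v)    ≡⟨ ⊕-assoc u x v ⟨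
  (u ⊕ x) ⊕ v    ≡⟨ cong (_⊕ v) (⊕-comm u x) ⟩
  (x ⊕ u) ⊕ v    ≡⟨ ⊕-assoc x u v ⟩
  x ⊕ (u ⊕ v)    ≡⟨ cong (x ⊕_) q ⟩
  x ⊕ t          ∎
  where open ≡-Reasoning

total : ∀ {r} → List (H r) → H r
total = foldr _⊕_ 𝟎

par : ℤ → Parity
par z = parity ℤ.∣ z ∣

par-⊖ : ∀ m n → par (m ⊖ n) ≡ parity m ℙ.+ parity n
par-⊖ zero    zero    = refl
par-⊖ zero    (suc n) = refl
par-⊖ (suc m) zero    = sym (ℙ.+-identityʳ (parity (suc m)))
par-⊖ (suc m) (suc n) = begin
  par (suc m ⊖ suc n)                  ≡⟨ cong par (ℤ.[1+m]⊖[1+n]≡m⊖n m n) ⟩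
  par (m ⊖ n)                          ≡⟨ par-⊖ m n ⟩
  parity m ℙ.+ parity n                ≡⟨ flip (parity m) (parity n) ⟨
  (parity m ℙ.⁻¹) ℙ.+ (parity n ℙ.⁻¹)  ≡⟨ cong₂ ℙ._+_ (parity-suc m) (parity-suc n) ⟨
  parity (suc m) ℙ.+ parity (suc n)    ∎
  where
  open ≡-Reasoning
  parity-suc : ∀ k → parity (suc k) ≡ (parity k) ℙ.⁻¹
  parity-suc k = ℙ.+-homo-+ 1 k
  flip : ∀ p q → (p ℙ.⁻¹) ℙ.+ (q ℙ.⁻¹) ≡ p ℙ.+ q
  flip 0ℙ q  = ℙ.⁻¹-involutive q
  flip 1ℙ q = refl

par-+ : ∀ a b → par (a ℤ.+ b) ≡ par a ℙ.+ par b
par-+ (ℤ.+ m)  (ℤ.+ n)  = ℙ.+-homo-+ m n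
par-+ (ℤ.+ m)  -[1+ n ] = par-⊖ m (suc n)
par-+ -[1+ m ] (ℤ.+ n)  = trans (par-⊖ n (suc m)) (ℙ.+-comm (parity n) _)
par-+ -[1+ m ] -[1+ n ] = trans (cong parity (cong suc (sym (ℕ.+-suc m n)))) (ℙ.+-homo-+ (suc m) (suc n))

par-* : ∀ a b → par (a ℤ.* b) ≡ par a ℙ.* par b
par-* a b = trans (cong parity (ℤ.abs-* a b)) (ℙ.*-homo-* ℤ.∣ a ∣ ℤ.∣ b ∣)

-- Each splitting has a vanishing factor as soon as no two complementary sublists can satisfy Φ and
-- Ψ. Both predicates see only length and sum, so giving x to one side merely shifts its predicate;
-- hence the induction varies Φ and Ψ.
⊛-vanish : ∀ {r} {B : Set} (h : B → H r) (Φ Ψ : ℕ → H r → Set) (F G : Series B) →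
           (∀ ys → F ys ≡ 0ℤ ⊎ Φ (length ys) (total (map h ys))) →
           (∀ ys → G ys ≡ 0ℤ ⊎ Ψ (length ys) (total (map h ys))) →
           ∀ xs →
           (∀ i j u v → i ℕ.+ j ≡ length xs → u ⊕ v ≡ total (map h xs) → Φ i u → Ψ j v → ⊥) →
           (F ⊛ G) xs ≡ 0ℤ
⊛-vanish h Φ Ψ F G f g [] disj with f [] | g []
... | inj₁ F≡0 | _        = trans (cong (ℤ._* G []) F≡0) (ℤ.*-zeroˡ (G []))
... | inj₂ _   | inj₁ G≡0 = trans (cong (F [] ℤ.*_) G≡0) (ℤ.*-zeroʳ (F []))
... | inj₂ φ   | inj₂ ψ   = contradiction ψ (disj 0 0 𝟎 𝟎 refl (⊕-self 𝟎) φ)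
⊛-vanish h Φ Ψ F G f g (x ∷ xs) disj = cong₂ ℤ._+_
  (⊛-vanish h (λ i u → Φ (suc i) (h x ⊕ u)) Ψ (∂ x F) G (f ∘ (x ∷_)) g xs
    (λ i j u v p q → disj (suc i) j (h x ⊕ u) v (cong suc p) (trans (⊕-assoc (h x) u v) (cong (h x ⊕_) q))))
  (⊛-vanish h Φ (λ j v → Ψ (suc j) (h x ⊕ v)) F (∂ x G) f (g ∘ (x ∷_)) xs
    (λ i j u v p q → disj i (suc j) u (h x ⊕ v) (trans (ℕ.+-suc i j) (cong suc p)) (⊕-insertʳ (h x) u v q)))

-- The sum over all sublists ys of w(length ys) · φ(total ys) in 𝔽₂. Allowing any weight w, and not
-- only the indicator of one length, makes the family closed under removal of a list element.
subsetSum : ∀ {r} → (ℕ → Parity) → (H r → Parity) → List (H r) → Parity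
subsetSum w φ []       = w 0 ℙ.* φ 𝟎
subsetSum w φ (x ∷ xs) = subsetSum (w ∘ suc) (φ ∘ (x ⊕_)) xs ℙ.+ subsetSum w φ xs

-- The last two hypotheses say that, for complementary sublists, the condition on the second follows
-- from the condition on the first. Its indicator then drops out, and only the choice of the first
-- sublist is counted.
par-⊛ : ∀ {r} {B : Set} (h : B → H r) (w v : ℕ → Parity) (φ ψ : H r → Parity) (F G : Series B) →
        (∀ ys → par (F ys) ≡ w (length ys) ℙ.* φ (total (map h ys))) →
        (∀ ys → par (G ys) ≡ v (length ys) ℙ.* ψ (total (map h ys))) →
        ∀ xs →
        (∀ i j → i ℕ.+ j ≡ length xs → w i ℙ.* v j ≡ w i) →
        (∀ y z → y ⊕ z ≡ total (map h xs) → φ y ℙ.* ψ z ≡ φ y) →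
        par ((F ⊛ G) xs) ≡ subsetSum w φ (map h xs)
par-⊛ h w v φ ψ F G f g [] wv φψ = begin
  par (F [] ℤ.* G [])                  ≡⟨ par-* (F []) (G []) ⟩
  par (F []) ℙ.* par (G [])            ≡⟨ cong₂ ℙ._*_ (f []) (g []) ⟩
  (w 0 ℙ.* φ 𝟎) ℙ.* (v 0 ℙ.* ψ 𝟎)      ≡⟨ *-interchange (w 0) _ _ _ ⟩
  (w 0 ℙ.* v 0) ℙ.* (φ 𝟎 ℙ.* ψ 𝟎)      ≡⟨ cong₂ ℙ._*_ (wv 0 0 refl) (φψ 𝟎 𝟎 (⊕-self 𝟎)) ⟩
  w 0 ℙ.* φ 𝟎                          ∎
  where
  open ≡-Reasoning
  open import Algebra.Properties.CommutativeSemigroup ℙ.*-commutativeSemigroup using () renaming (interchange to *-interchange)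
par-⊛ h w v φ ψ F G f g (x ∷ xs) wv φψ = trans (par-+ ((∂ x F ⊛ G) xs) ((F ⊛ ∂ x G) xs)) (cong₂ ℙ._+_
  (par-⊛ h (w ∘ suc) v (φ ∘ (h x ⊕_)) ψ (∂ x F) G (f ∘ (x ∷_)) g xs
    (λ i j p → wv (suc i) j (cong suc p))
    (λ y z q → φψ (h x ⊕ y) z (trans (⊕-assoc (h x) y z) (cong (h x ⊕_) q))))
  (par-⊛ h w (v ∘ suc) φ (ψ ∘ (h x ⊕_)) F (∂ x G) f (g ∘ (x ∷_)) xs
    (λ i j p → wv i (suc j) (trans (ℕ.+-suc i j) (cong suc p)))
    (λ y z q → φψ y (h x ⊕ z) (⊕-insertʳ (h x) y z q))))

-- Finite differences and degree over 𝔽₂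

Δ : ∀ {r} → H r → (H r → Parity) → H r → Parity
Δ x φ u = φ (x ⊕ u) ℙ.+ φ u

pascal : (ℕ → Parity) → ℕ → Parity
pascal w i = w i ℙ.+ w (suc i)

subsetSum-0 : ∀ {r} w {φ : H r → Parity} → (∀ u → φ u ≡ 0ℙ) → ∀ xs → subsetSum w φ xs ≡ 0ℙ
subsetSum-0 w φ≡0 []       = trans (cong (w 0 ℙ.*_) (φ≡0 𝟎)) (ℙ.*-zeroʳ (w 0))
subsetSum-0 w φ≡0 (x ∷ xs) =
  cong₂ ℙ._+_ (subsetSum-0 (w ∘ suc) (φ≡0 ∘ (x ⊕_)) xs) (subsetSum-0 w φ≡0 xs)

subsetSum-+ˡ : ∀ {r} w v (φ : H r → Parity) xs →
               subsetSum (λ i → w i ℙ.+ v i) φ xs ≡ subsetSum w φ xs ℙ.+ subsetSum v φ xs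
subsetSum-+ˡ w v φ []       = ℙ.*-distribʳ-+ (φ 𝟎) (w 0) (v 0)
subsetSum-+ˡ w v φ (x ∷ xs) = trans
  (cong₂ ℙ._+_ (subsetSum-+ˡ (w ∘ suc) (v ∘ suc) (φ ∘ (x ⊕_)) xs) (subsetSum-+ˡ w v φ xs))
  (+-interchange (subsetSum (w ∘ suc) (φ ∘ (x ⊕_)) xs) _ _ _)

subsetSum-+ʳ : ∀ {r} w (φ ψ : H r → Parity) xs →
               subsetSum w (λ u → φ u ℙ.+ ψ u) xs ≡ subsetSum w φ xs ℙ.+ subsetSum w ψ xs
subsetSum-+ʳ w φ ψ []       = ℙ.*-distribˡ-+ (w 0) (φ 𝟎) (ψ 𝟎)
subsetSum-+ʳ w φ ψ (x ∷ xs) = trans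
  (cong₂ ℙ._+_ (subsetSum-+ʳ (w ∘ suc) (φ ∘ (x ⊕_)) (ψ ∘ (x ⊕_)) xs) (subsetSum-+ʳ w φ ψ xs))
  (+-interchange (subsetSum (w ∘ suc) (φ ∘ (x ⊕_)) xs) _ _ _)

-- Replace φ(x ⊕ u) by Δφ(u) + φ(u) in the sublists that contain x: the difference has lower degree,
-- and the two sums over φ merge their weights as in Pascal's rule.
subsetSum-Δ : ∀ {r} w (φ : H r → Parity) x xs →
              subsetSum w φ (x ∷ xs) ≡ subsetSum (w ∘ suc) (Δ x φ) xs ℙ.+ subsetSum (pascal w) φ xs
subsetSum-Δ w φ x xs = sym (trans
  (cong₂ ℙ._+_ (subsetSum-+ʳ (w ∘ suc) (φ ∘ (x ⊕_)) φ xs) (subsetSum-+ˡ w (w ∘ suc) φ xs))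
  (cancel (subsetSum (w ∘ suc) (φ ∘ (x ⊕_)) xs) (subsetSum (w ∘ suc) φ xs) (subsetSum w φ xs)))
  where
  cancel : ∀ p q s → (p ℙ.+ q) ℙ.+ (s ℙ.+ q) ≡ p ℙ.+ s
  cancel 0ℙ 0ℙ s = ℙ.+-identityʳ s
  cancel 0ℙ 1ℙ 0ℙ = refl
  cancel 0ℙ 1ℙ 1ℙ = refl
  cancel 1ℙ 0ℙ s = cong ℙ._⁻¹ (ℙ.+-identityʳ s)
  cancel 1ℙ 1ℙ 0ℙ = refl
  cancel 1ℙ 1ℙ 1ℙ = refl

-- Degree is measured by annihilation under d successive differences, so functions never have to be
-- presented as polynomials.
Degree< : ∀ {r} → ℕ → (H r → Parity) → Set
Degree< zero    φ = ∀ u → φ u ≡ 0ℙ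
Degree< (suc d) φ = ∀ x → Degree< d (Δ x φ)

pascal^ : ℕ → (ℕ → Parity) → ℕ → Parity
pascal^ zero    w = w
pascal^ (suc a) w = pascal^ a (pascal w)

shift : ℕ → (ℕ → Parity) → ℕ → Parity
shift zero    w = w
shift (suc j) w = shift j (w ∘ suc)

shift-pascal : ∀ j w → shift j (pascal w) ≡ pascal (shift j w)
shift-pascal zero    w = refl
shift-pascal (suc j) w = shift-pascal j (w ∘ suc)

-- Newton's expansion writes φ (total ys) as a sum over the sets of at most d − 1
-- members of ys; the hypothesis says that each such set lies in oddly many
-- sublists, counted with weight w, so all of them contribute to φ (total xs).
subsetSum-total : ∀ {r} d (φ : H r → Parity) w xs → Degree< d φ →
                  (∀ j a → j ℕ.< d → j ℕ.+ a ≡ length xs → pascal^ a (shift j w) 0 ≡ 1ℙ) →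
                  subsetSum w φ xs ≡ φ (total xs)
subsetSum-total zero    φ w xs       deg odd = trans (subsetSum-0 w deg xs) (sym (deg (total xs)))
subsetSum-total (suc d) φ w []       deg odd = cong (ℙ._* φ 𝟎) (odd 0 0 ℕ.z<s refl)
subsetSum-total (suc d) φ w (x ∷ xs) deg odd = begin
  subsetSum w φ (x ∷ xs)
    ≡⟨ subsetSum-Δ w φ x xs ⟩
  subsetSum (w ∘ suc) (Δ x φ) xs ℙ.+ subsetSum (pascal w) φ xs
    ≡⟨ cong₂ ℙ._+_
         (subsetSum-total d (Δ x φ) (w ∘ suc) xs (deg x) (λ j a j<d p → odd (suc j) a (ℕ.s<s j<d) (cong suc p)))
         (subsetSum-total (suc d) φ (pascal w) xs deg (λ j a j<d p →
            trans (cong (λ v → pascal^ a v 0) (shift-pascal j w))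
                  (odd j (suc a) j<d (trans (ℕ.+-suc j a) (cong suc p))))) ⟩
  (φ (x ⊕ total xs) ℙ.+ φ (total xs)) ℙ.+ φ (total xs)
    ≡⟨ ℙ.+-assoc (φ (x ⊕ total xs)) _ _ ⟩
  φ (x ⊕ total xs) ℙ.+ (φ (total xs) ℙ.+ φ (total xs))
    ≡⟨ cong (φ (x ⊕ total xs) ℙ.+_) (ℙ.p+p≡0ℙ (φ (total xs))) ⟩
  φ (x ⊕ total xs) ℙ.+ 0ℙ
    ≡⟨ ℙ.+-identityʳ _ ⟩
  φ (x ⊕ total xs) ∎
  where open ≡-Reasoning

Degree<-cong : ∀ {r} d {φ} ψ → φ ≗ ψ → Degree< {r} d φ → Degree< d ψ
Degree<-cong zero    ψ eq deg u = trans (sym (eq u)) (deg u)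
Degree<-cong (suc d) ψ eq deg x = Degree<-cong d (Δ x ψ) (λ u → cong₂ ℙ._+_ (eq (x ⊕ u)) (eq u)) (deg x)

Degree<-+ : ∀ {r} d φ ψ → Degree< {r} d φ → Degree< d ψ → Degree< d (λ u → φ u ℙ.+ ψ u)
Degree<-+ zero    φ ψ p q u = cong₂ ℙ._+_ (p u) (q u)
Degree<-+ (suc d) φ ψ p q x =
  Degree<-cong d _ (λ u → +-interchange (φ (x ⊕ u)) _ _ _) (Degree<-+ d (Δ x φ) (Δ x ψ) (p x) (q x))

Degree<-* : ∀ {r} d c φ → Degree< {r} d φ → Degree< d (λ u → c ℙ.* φ u)
Degree<-* zero    c φ p u = trans (cong (c ℙ.*_) (p u)) (ℙ.*-zeroʳ c)
Degree<-* (suc d) c φ p x = Degree<-cong d _ (λ u → ℙ.*-distribˡ-+ c _ _) (Degree<-* d c (Δ x φ) (p x))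

tail-⊕ : ∀ {r} (x y : H (suc r)) → tail (x ⊕ y) ≡ tail x ⊕ tail y
tail-⊕ (_ ∷ _) (_ ∷ _) = refl

head-⊕ : ∀ {r} (x y : H (suc r)) → head (x ⊕ y) ≡ head x ℙ.+ head y
head-⊕ (_ ∷ _) (_ ∷ _) = refl

Degree<-tail : ∀ {r} d φ → Degree< {r} d φ → Degree< d (φ ∘ tail)
Degree<-tail zero    φ p u = p (tail u)
Degree<-tail (suc d) φ p x = Degree<-cong d _
  (λ u → cong (λ y → φ y ℙ.+ φ (tail u)) (sym (tail-⊕ x u))) (Degree<-tail d (Δ (tail x) φ) (p (tail x)))

Degree<-translate : ∀ {r} d y φ → Degree< {r} d φ → Degree< d (φ ∘ (y ⊕_))
Degree<-translate zero    y φ p u = p (y ⊕ u)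
Degree<-translate (suc d) y φ p x = Degree<-cong d _
  (λ u → cong (λ v → φ v ℙ.+ φ (y ⊕ u)) (sym (⊕-insertʳ x y u refl)))
  (Degree<-translate d y (Δ x φ) (p x))

affine : ∀ {r} → Parity → (H r → Parity) → H (suc r) → Parity
affine c φ u = (c ℙ.+ head u) ℙ.* φ (tail u)

-- By the discrete Leibniz rule, the difference along `q ∷ h` is a translated affine factor times
-- Δφ, plus the constant q times φ on tails. The first has its degree bounded by induction, the
-- second by that of φ.
Degree<-affine : ∀ {r} d c φ → Degree< {r} d φ → Degree< (suc d) (affine c φ)
Degree<-affine zero    c φ p x u = cong₂ ℙ._+_ (vanish (x ⊕ u)) (vanish u)
  where
  vanish : ∀ v → affine c φ v ≡ 0ℙ
  vanish v = trans (cong ((c ℙ.+ head v) ℙ.*_) (p (tail v))) (ℙ.*-zeroʳ (c ℙ.+ head v))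
Degree<-affine (suc d) c φ p (q ∷ h) =
  Degree<-cong (suc d) {λ u → affine (c ℙ.+ q) (Δ h φ) u ℙ.+ (q ℙ.* φ (tail u))} (Δ (q ∷ h) (affine c φ))
  (λ { (s ∷ u) → leibniz c q s (φ (h ⊕ u)) (φ u) })
  (Degree<-+ (suc d) (affine (c ℙ.+ q) (Δ h φ)) (λ u → q ℙ.* φ (tail u))
    (Degree<-affine d (c ℙ.+ q) (Δ h φ) (p h))
    (Degree<-* (suc d) q (φ ∘ tail) (Degree<-tail (suc d) φ p)))
  where
  leibniz : ∀ c q s a b → (((c ℙ.+ q) ℙ.+ s) ℙ.* (a ℙ.+ b)) ℙ.+ (q ℙ.* b)
                        ≡ ((c ℙ.+ (q ℙ.+ s)) ℙ.* a) ℙ.+ ((c ℙ.+ s) ℙ.* b)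
  leibniz c q s a b = begin
    (((c ℙ.+ q) ℙ.+ s) ℙ.* (a ℙ.+ b)) ℙ.+ (q ℙ.* b)
      ≡⟨ cong (λ t → (t ℙ.* (a ℙ.+ b)) ℙ.+ (q ℙ.* b)) (ℙ.+-assoc c q s) ⟩
    (k ℙ.* (a ℙ.+ b)) ℙ.+ (q ℙ.* b)
      ≡⟨ cong (ℙ._+ (q ℙ.* b)) (ℙ.*-distribˡ-+ k a b) ⟩
    ((k ℙ.* a) ℙ.+ (k ℙ.* b)) ℙ.+ (q ℙ.* b)
      ≡⟨ ℙ.+-assoc (k ℙ.* a) _ _ ⟩
    (k ℙ.* a) ℙ.+ ((k ℙ.* b) ℙ.+ (q ℙ.* b))
      ≡⟨ cong ((k ℙ.* a) ℙ.+_) (ℙ.*-distribʳ-+ b k q) ⟨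
    (k ℙ.* a) ℙ.+ ((k ℙ.+ q) ℙ.* b)
      ≡⟨ cong (λ t → (k ℙ.* a) ℙ.+ (t ℙ.* b)) (cancel c q s) ⟩
    _ ∎
    where
    open ≡-Reasoning
    k = c ℙ.+ (q ℙ.+ s)
    cancel : ∀ c q s → c ℙ.+ (q ℙ.+ s) ℙ.+ q ≡ c ℙ.+ s
    cancel c q s = begin
      c ℙ.+ (q ℙ.+ s) ℙ.+ q    ≡⟨ ℙ.+-assoc c _ q ⟩
      c ℙ.+ (q ℙ.+ s ℙ.+ q)    ≡⟨ cong (λ t → c ℙ.+ (t ℙ.+ q)) (ℙ.+-comm q s) ⟩
      c ℙ.+ (s ℙ.+ q ℙ.+ q)    ≡⟨ cong (c ℙ.+_) (ℙ.+-assoc s q q) ⟩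
      c ℙ.+ (s ℙ.+ (q ℙ.+ q))  ≡⟨ cong (λ t → c ℙ.+ (s ℙ.+ t)) (ℙ.p+p≡0ℙ q) ⟩
      c ℙ.+ (s ℙ.+ 0ℙ)         ≡⟨ cong (c ℙ.+_) (ℙ.+-identityʳ s) ⟩
      c ℙ.+ s                  ∎

isZero : ∀ {r} → H r → Parity
isZero []      = 1ℙ
isZero (p ∷ u) = (1ℙ ℙ.+ p) ℙ.* isZero u

isZero-𝟎 : ∀ r → isZero (𝟎 {r}) ≡ 1ℙ
isZero-𝟎 zero    = refl
isZero-𝟎 (suc r) = isZero-𝟎 r

isZero-≢ : ∀ {r} (u : H r) → u ≢ 𝟎 → isZero u ≡ 0ℙ
isZero-≢ []       u≢0 = contradiction refl u≢0
isZero-≢ (0ℙ ∷ u) u≢0 = isZero-≢ u (u≢0 ∘ cong (0ℙ ∷_))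
isZero-≢ (1ℙ ∷ u) u≢0 = refl

isZero-degree : ∀ r → Degree< (suc r) (isZero {r})
isZero-degree zero    x u = cong₂ ℙ._+_ (one (x ⊕ u)) (one u)
  where
  one : (v : H 0) → isZero v ≡ 1ℙ
  one [] = refl
isZero-degree (suc r) = Degree<-cong (suc (suc r)) {affine 1ℙ isZero} isZero (λ { (p ∷ u) → refl })
  (Degree<-affine (suc r) 1ℙ isZero (isZero-degree r))

-- Binomial coefficients modulo 2

isEqual : ℕ → ℕ → Parity
isEqual zero    zero    = 1ℙ
isEqual zero    (suc n) = 0ℙ
isEqual (suc m) zero    = 0ℙ
isEqual (suc m) (suc n) = isEqual m n

isEqual-refl : ∀ n → isEqual n n ≡ 1ℙ
isEqual-refl zero    = refl
isEqual-refl (suc n) = isEqual-refl n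

isEqual-≢ : ∀ m n → m ≢ n → isEqual m n ≡ 0ℙ
isEqual-≢ zero    zero    m≢n = contradiction refl m≢n
isEqual-≢ zero    (suc n) m≢n = refl
isEqual-≢ (suc m) zero    m≢n = refl
isEqual-≢ (suc m) (suc n) m≢n = isEqual-≢ m n (m≢n ∘ cong suc)

pascal^-cong : ∀ a {w v : ℕ → Parity} → w ≗ v → pascal^ a w ≗ pascal^ a v
pascal^-cong zero    eq = eq
pascal^-cong (suc a) eq = pascal^-cong a (λ i → cong₂ ℙ._+_ (eq i) (eq (suc i)))

pascal^-+ : ∀ a b w → pascal^ (a ℕ.+ b) w ≡ pascal^ b (pascal^ a w)
pascal^-+ zero    b w = refl
pascal^-+ (suc a) b w = pascal^-+ a b (pascal w)

-- (1 + τ)^(2^r) = 1 + τ^(2^r) modulo 2, for the shift operator τ.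
pascal^-2^ : ∀ r w i → pascal^ (2 ^ r) w i ≡ w i ℙ.+ w (2 ^ r ℕ.+ i)
pascal^-2^ zero    w i = refl
pascal^-2^ (suc r) w i = begin
  pascal^ (m ℕ.+ (m ℕ.+ 0)) w i
    ≡⟨ cong (λ k → pascal^ (m ℕ.+ k) w i) (ℕ.+-identityʳ m) ⟩
  pascal^ (m ℕ.+ m) w i
    ≡⟨ cong (λ v → v i) (pascal^-+ m m w) ⟩
  pascal^ m (pascal^ m w) i
    ≡⟨ pascal^-cong m (pascal^-2^ r w) i ⟩
  pascal^ m (λ k → w k ℙ.+ w (m ℕ.+ k)) i
    ≡⟨ pascal^-2^ r _ i ⟩
  (w i ℙ.+ w (m ℕ.+ i)) ℙ.+ (w (m ℕ.+ i) ℙ.+ w (m ℕ.+ (m ℕ.+ i)))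
    ≡⟨ cancel (w i) (w (m ℕ.+ i)) _ ⟩
  w i ℙ.+ w (m ℕ.+ (m ℕ.+ i))
    ≡⟨ cong (λ k → w i ℙ.+ w k) (trans (sym (ℕ.+-assoc m m i)) (cong (λ k → m ℕ.+ k ℕ.+ i) (sym (ℕ.+-identityʳ m)))) ⟩
  w i ℙ.+ w (m ℕ.+ (m ℕ.+ 0) ℕ.+ i) ∎
  where
  open ≡-Reasoning
  m = 2 ^ r
  cancel : ∀ p q s → (p ℙ.+ q) ℙ.+ (q ℙ.+ s) ≡ p ℙ.+ s
  cancel p q s = trans (ℙ.+-assoc p q _) (cong (p ℙ.+_)
    (trans (sym (ℙ.+-assoc q q s)) (cong (ℙ._+ s) (ℙ.p+p≡0ℙ q))))

-- The left side is the sum of C(b, i) · w(i), where only i = b survives, with coefficient 1.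
pascal^-lowest : ∀ b w → (∀ i → i ℕ.< b → w i ≡ 0ℙ) → pascal^ b w 0 ≡ w b
pascal^-lowest zero    w low = refl
pascal^-lowest (suc b) w low = trans
  (pascal^-lowest b (pascal w) (λ i i<b → cong₂ ℙ._+_ (low i (ℕ.m<n⇒m<1+n i<b)) (low (suc i) (ℕ.s<s i<b))))
  (cong (ℙ._+ w (suc b)) (low b (ℕ.n<1+n b)))

shift-apply : ∀ j w i → shift j w i ≡ w (j ℕ.+ i)
shift-apply zero    w i = refl
shift-apply (suc j) w i = shift-apply j (w ∘ suc) i

-- C(2n − 1 − j, n − 1 − j) is odd for n = 2^r and j < n.
binomial-odd : ∀ r j a → j ℕ.< 2 ^ r → suc (j ℕ.+ a) ≡ 2 ^ suc r →
               pascal^ a (shift j (isEqual (2 ^ r) ∘ suc)) 0 ≡ 1ℙ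
binomial-odd r j a j<n p with ℕ.m≤n⇒∃[o]m+o≡n j<n
... | b , eq = begin
  pascal^ a u 0
    ≡⟨ cong (λ k → pascal^ k u 0) a≡n+b ⟩
  pascal^ (n ℕ.+ b) u 0
    ≡⟨ cong (λ v → v 0) (pascal^-+ n b u) ⟩
  pascal^ b (pascal^ n u) 0
    -- The weight u marks the single index n - 1 - j = b. Shifted by n it marks nothing, so the
    -- n-fold Pascal step leaves it unchanged and only b further steps remain.
    ≡⟨ pascal^-cong b (λ i → trans (pascal^-2^ r u i) (value i)) 0 ⟩
  pascal^ b (isEqual b) 0
    ≡⟨ pascal^-lowest b (isEqual b) (λ i i<b → isEqual-≢ b i (ℕ.<⇒≢ i<b ∘ sym)) ⟩
  isEqual b b
    ≡⟨ isEqual-refl b ⟩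
  1ℙ ∎
  where
  open ≡-Reasoning
  n = 2 ^ r
  u = shift j (isEqual n ∘ suc)
  a≡n+b : a ≡ n ℕ.+ b
  a≡n+b = ℕ.+-cancelˡ-≡ (suc j) a (n ℕ.+ b) (begin
    suc j ℕ.+ a          ≡⟨ p ⟩
    n ℕ.+ (n ℕ.+ 0)      ≡⟨ cong (n ℕ.+_) (ℕ.+-identityʳ n) ⟩
    n ℕ.+ n              ≡⟨ cong (n ℕ.+_) eq ⟨
    n ℕ.+ (suc j ℕ.+ b)  ≡⟨ ℕ.+-assoc n (suc j) b ⟨
    n ℕ.+ suc j ℕ.+ b    ≡⟨ cong (ℕ._+ b) (ℕ.+-comm n (suc j)) ⟩
    suc j ℕ.+ n ℕ.+ b    ≡⟨ ℕ.+-assoc (suc j) n b ⟩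
    suc j ℕ.+ (n ℕ.+ b)  ∎)
  cancel : ∀ k b i → isEqual (k ℕ.+ b) (k ℕ.+ i) ≡ isEqual b i
  cancel zero    b i = refl
  cancel (suc k) b i = cancel k b i
  value : ∀ i → u i ℙ.+ u (n ℕ.+ i) ≡ isEqual b i
  value i = begin
    u i ℙ.+ u (n ℕ.+ i)
      ≡⟨ cong₂ ℙ._+_ (shift-apply j _ i) (shift-apply j _ (n ℕ.+ i)) ⟩
    isEqual n (suc j ℕ.+ i) ℙ.+ isEqual n (suc j ℕ.+ (n ℕ.+ i))
      ≡⟨ cong₂ (λ k q → isEqual k (suc j ℕ.+ i) ℙ.+ q) (sym eq)
           (isEqual-≢ n _ (ℕ.<⇒≢ (ℕ.s≤s (ℕ.≤-trans (ℕ.m≤m+n n i) (ℕ.m≤n+m (n ℕ.+ i) j))))) ⟩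
    isEqual (suc j ℕ.+ b) (suc j ℕ.+ i) ℙ.+ 0ℙ
      ≡⟨ ℙ.+-identityʳ _ ⟩
    isEqual (suc j ℕ.+ b) (suc j ℕ.+ i)
      ≡⟨ cancel (suc j) b i ⟩
    isEqual b i ∎

-- The product of the characters

sgn : Parity → ℤ
sgn 0ℙ = 1ℤ
sgn 1ℙ = -1ℤ

sgn-+ : ∀ p q → sgn (p ℙ.+ q) ≡ sgn p ℤ.* sgn q
sgn-+ 0ℙ 0ℙ = refl
sgn-+ 0ℙ 1ℙ = refl
sgn-+ 1ℙ 0ℙ = refl
sgn-+ 1ℙ 1ℙ = refl

sgn-square : ∀ p → sgn p ℤ.* sgn p ≡ 1ℤ
sgn-square 0ℙ = refl
sgn-square 1ℙ = refl

par-sgn : ∀ p z → par (sgn p ℤ.* z) ≡ par z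
par-sgn 0ℙ z = par-* 1ℤ z
par-sgn 1ℙ z = par-* -1ℤ z

linear : {A : Set} → (A → ℤ) → Series A
linear ℓ []          = 0ℤ
linear ℓ (x ∷ [])    = ℓ x
linear ℓ (_ ∷ _ ∷ _) = 0ℤ

headSign : ∀ {r} → H (suc r) → ℤ
headSign = sgn ∘ head

headSign-square : ∀ {r} (x : H (suc r)) → headSign x ℤ.* headSign x ≡ 1ℤ
headSign-square = sgn-square ∘ head

head-total : ∀ {r} (xs : List (H (suc r))) → twistFactor headSign xs ≡ sgn (head (total xs))
head-total []       = refl
head-total (x ∷ xs) = begin
  sgn (head x) ℤ.* twistFactor headSign xs   ≡⟨ cong (sgn (head x) ℤ.*_) (head-total xs) ⟩
  sgn (head x) ℤ.* sgn (head (total xs))     ≡⟨ sgn-+ (head x) _ ⟨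
  sgn (head x ℙ.+ head (total xs))           ≡⟨ cong sgn (head-⊕ x (total xs)) ⟨
  sgn (head (total (x ∷ xs)))                ∎
  where open ≡-Reasoning

total-tail : ∀ {r} (xs : List (H (suc r))) → total (map tail xs) ≡ tail (total xs)
total-tail []       = refl
total-tail (x ∷ xs) = trans (cong (tail x ⊕_) (total-tail xs)) (sym (tail-⊕ x (total xs)))

-- The product of the linear forms Σₓ χ(x) zₓ over all characters χ of H r,
-- those of H (suc r) being the χ ∘ tail and their products with headSign.
charProduct : ∀ r → Series (H r)
charProduct zero    = linear (λ _ → 1ℤ)
charProduct (suc r) = V ⊛ twist headSign V
  where V = pull tail (charProduct r)

-- The recursion mirrors that of `charProduct`: two factors contribute 2^e each and their pairing
-- one more 2, whence e becomes 2e + 1.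
2^_∸1 : ℕ → ℕ
2^ zero  ∸1 = 0
2^ suc r ∸1 = suc (2^ r ∸1 ℕ.+ 2^ r ∸1)

2^≡1+2^∸1 : ∀ r → 2 ^ r ≡ suc (2^ r ∸1)
2^≡1+2^∸1 zero    = refl
2^≡1+2^∸1 (suc r) = begin
  2 ^ r ℕ.+ (2 ^ r ℕ.+ 0)                ≡⟨ cong (2 ^ r ℕ.+_) (ℕ.+-identityʳ (2 ^ r)) ⟩
  2 ^ r ℕ.+ 2 ^ r                        ≡⟨ cong₂ ℕ._+_ (2^≡1+2^∸1 r) (2^≡1+2^∸1 r) ⟩
  suc (2^ r ∸1) ℕ.+ suc (2^ r ∸1)        ≡⟨ cong suc (ℕ.+-suc (2^ r ∸1) _) ⟩
  suc (suc (2^ r ∸1 ℕ.+ 2^ r ∸1))        ∎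
  where open ≡-Reasoning

keepEven : Parity → ℤ → ℤ
keepEven 0ℙ z = z
keepEven 1ℙ z = 0ℤ

keepEven-double : ∀ p z → z ℤ.+ sgn p ℤ.* z ≡ ℤ.+ 2 ℤ.* keepEven p z
keepEven-double 0ℙ z = trans (cong (ℤ._+ 1ℤ ℤ.* z) (sym (ℤ.*-identityˡ z))) (sym (ℤ.*-distribʳ-+ z 1ℤ 1ℤ))
keepEven-double 1ℙ z = trans (cong (ℤ._+_ z) (ℤ.-1*i≡-i z)) (ℤ.+-inverseʳ z)

-- charProduct r divided by 2^(2^r − 1): at each step the two halves of Leibniz'
-- rule agree or cancel, so a factor 2 splits off and only one of them is kept.
oddPart : ∀ r → Series (H r)
oddPart zero             = linear (λ _ → 1ℤ)
oddPart (suc r) []       = 0ℤ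
oddPart (suc r) (x ∷ xs) = keepEven (head (total (x ∷ xs))) ((∂ x V ⊛ twist headSign V) xs)
  where V = pull tail (oddPart r)

Balanced : ∀ {r} → List (H r) → Set
Balanced {r} xs = length xs ≡ 2 ^ r × total xs ≡ 𝟎

r<2^r : ∀ r → r ℕ.< 2 ^ r
r<2^r zero    = ℕ.s≤s ℕ.z≤n
r<2^r (suc r) = ℕ.+-mono-≤ (ℕ.m^n>0 2 r) (ℕ.≤-trans (r<2^r r) (ℕ.m≤m+n (2 ^ r) 0))

isEqual-*-≡ : ∀ k i j → i ℕ.+ j ≡ k ℕ.+ k → isEqual k i ℙ.* isEqual k j ≡ isEqual k i
isEqual-*-≡ k i j p with k ℕ.≟ i
... | no k≢i = trans (cong (ℙ._* isEqual k j) (isEqual-≢ k i k≢i)) (sym (isEqual-≢ k i k≢i))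
... | yes refl = trans (cong (isEqual k k ℙ.*_) (trans (cong (isEqual k) (ℕ.+-cancelˡ-≡ k j k p)) (isEqual-refl k)))
                       (ℙ.*-identityʳ (isEqual k k))

⊕≡𝟎⇒≡ : ∀ {r} (x y : H r) → x ⊕ y ≡ 𝟎 → x ≡ y
⊕≡𝟎⇒≡ []       []       _ = refl
⊕≡𝟎⇒≡ (0ℙ ∷ x) (0ℙ ∷ y) p = cong (0ℙ ∷_) (⊕≡𝟎⇒≡ x y (cong tail p))
⊕≡𝟎⇒≡ (1ℙ ∷ x) (1ℙ ∷ y) p = cong (1ℙ ∷_) (⊕≡𝟎⇒≡ x y (cong tail p))
⊕≡𝟎⇒≡ (0ℙ ∷ x) (1ℙ ∷ y) p with () ← cong head p
⊕≡𝟎⇒≡ (1ℙ ∷ x) (0ℙ ∷ y) p with () ← cong head p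

isZero-*-idem : ∀ {r} (x y : H r) → x ⊕ y ≡ 𝟎 → isZero x ℙ.* isZero y ≡ isZero x
isZero-*-idem x y p with refl ← ⊕≡𝟎⇒≡ x y p = ℙ.*-idem (isZero x)

-- The induction needs both forms of the claim at the previous rank: exact vanishing in ℤ off the
-- balanced lists, and, through the mutually proved `par-oddPart`, a product of indicators that can
-- be counted modulo 2.
oddPart-spec : ∀ r (xs : List (H r)) →
               (oddPart r xs ≡ 0ℤ × ¬ Balanced xs) ⊎ (Balanced xs × par (oddPart r xs) ≡ 1ℙ)

par-oddPart : ∀ r (xs : List (H r)) → par (oddPart r xs) ≡ isEqual (2 ^ r) (length xs) ℙ.* isZero (total xs)
par-oddPart r xs with oddPart-spec r xs
... | inj₂ ((p , q) , odd) = trans odd (sym (cong₂ ℙ._*_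
  (trans (cong (isEqual (2 ^ r)) p) (isEqual-refl (2 ^ r)))
  (trans (cong isZero q) (isZero-𝟎 r))))
... | inj₁ (zer , unbal) with length xs ℕ.≟ 2 ^ r | total xs ≟ᴴ 𝟎
...   | yes p | yes q = contradiction (p , q) unbal
...   | no p  | _     = trans (cong par zer) (sym (cong (ℙ._* isZero (total xs)) (isEqual-≢ _ _ (p ∘ sym))))
...   | yes p | no q  = trans (cong par zer) (sym (trans (cong (isEqual (2 ^ r) (length xs) ℙ.*_) (isZero-≢ _ q))
                                                          (ℙ.*-zeroʳ (isEqual (2 ^ r) (length xs)))))

oddPart-spec zero []           = inj₁ (refl , λ ())
oddPart-spec zero ([] ∷ [])    = inj₂ ((refl , refl) , refl)
oddPart-spec zero (x ∷ y ∷ xs) = inj₁ (refl , λ ())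
oddPart-spec (suc r) [] = inj₁ (refl , λ (p , _) → contradiction p (ℕ.<⇒≢ (ℕ.m^n>0 2 (suc r))))
oddPart-spec (suc r) (x ∷ xs) with head (total (x ∷ xs)) in headEq
... | 1ℙ = inj₁ (refl , λ (_ , q) → contradiction (trans (sym headEq) (cong head q)) (λ ()))
... | 0ℙ with (length (x ∷ xs) ℕ.≟ 2 ^ suc r) ×-dec (tail (total (x ∷ xs)) ≟ᴴ 𝟎)
...   | no unbal = inj₁ (vanish , λ (p , q) → unbal (p , cong tail q))
  where
  V = pull tail (oddPart r)
  V-supp : ∀ ys → V ys ≡ 0ℤ ⊎ (length ys ≡ 2 ^ r × total (map tail ys) ≡ 𝟎)
  V-supp ys with oddPart-spec r (map tail ys)
  ... | inj₁ (z , _)       = inj₁ z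
  ... | inj₂ ((p , q) , _) = inj₂ (trans (sym (length-map tail ys)) p , q)
  vanish : (∂ x V ⊛ twist headSign V) xs ≡ 0ℤ
  vanish = ⊛-vanish tail
    (λ i u → suc i ≡ 2 ^ r × tail x ⊕ u ≡ 𝟎) (λ j v → j ≡ 2 ^ r × v ≡ 𝟎)
    (∂ x V) (twist headSign V) (V-supp ∘ (x ∷_))
    (λ ys → Sum.map₁ (λ z → trans (cong (twistFactor headSign ys ℤ.*_) z) (ℤ.*-zeroʳ (twistFactor headSign ys))) (V-supp ys))
    xs
    -- Two balanced halves would join to a list of length 2n whose tails sum to zero.
    (λ i j u v p q (i-ok , u-ok) (j-ok , v-ok) → unbal
      ( trans (cong suc (sym p)) (trans (cong₂ ℕ._+_ i-ok j-ok) (cong (2 ^ r ℕ.+_) (sym (ℕ.+-identityʳ (2 ^ r)))))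
      , (begin
          tail (x ⊕ total xs)       ≡⟨ tail-⊕ x (total xs) ⟩
          tail x ⊕ tail (total xs)  ≡⟨ cong (tail x ⊕_) (total-tail xs) ⟨
          tail x ⊕ total (map tail xs) ≡⟨ cong (tail x ⊕_) q ⟨
          tail x ⊕ (u ⊕ v)          ≡⟨ ⊕-assoc (tail x) u v ⟨
          (tail x ⊕ u) ⊕ v          ≡⟨ cong₂ _⊕_ u-ok v-ok ⟩
          𝟎 ⊕ 𝟎                     ≡⟨ ⊕-self 𝟎 ⟩
          𝟎                         ∎)))
    where open ≡-Reasoning
...   | yes (p , q) = inj₂ ((p , total≡𝟎) , odd)
  where
  open ≡-Reasoning
  V = pull tail (oddPart r)
  n = 2 ^ r
  total≡𝟎 : total (x ∷ xs) ≡ 𝟎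
  total≡𝟎 with p ∷ u ← total (x ∷ xs) = cong₂ _∷_ headEq q
  tails : tail x ⊕ total (map tail xs) ≡ 𝟎
  tails = trans (cong (tail x ⊕_) (total-tail xs)) (trans (sym (tail-⊕ x (total xs))) q)
  par-V : ∀ ys → par (V ys) ≡ isEqual n (length ys) ℙ.* isZero (total (map tail ys))
  par-V ys = trans (par-oddPart r (map tail ys))
    (cong (λ k → isEqual n k ℙ.* isZero (total (map tail ys))) (length-map tail ys))
  par-twist : ∀ ys → par (twist headSign V ys) ≡ par (V ys)
  par-twist ys = trans (cong (λ s → par (s ℤ.* V ys)) (head-total ys)) (par-sgn (head (total ys)) (V ys))
  n+n : 2 ^ suc r ≡ n ℕ.+ n
  n+n = cong (n ℕ.+_) (ℕ.+-identityʳ n)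
  odd : par ((∂ x V ⊛ twist headSign V) xs) ≡ 1ℙ
  odd = begin
    par ((∂ x V ⊛ twist headSign V) xs)
      -- The element x always lies in the first half, so it is absorbed into the weight by `suc` and
      -- into the indicator by translation; what is counted are sublists of the other 2n - 1
      -- elements.
      ≡⟨ par-⊛ tail (isEqual n ∘ suc) (isEqual n) (isZero ∘ (tail x ⊕_)) isZero (∂ x V) (twist headSign V)
           (par-V ∘ (x ∷_)) (λ ys → trans (par-twist ys) (par-V ys)) xs
           (λ i j e → isEqual-*-≡ n (suc i) j (trans (cong suc e) (trans p n+n)))
           (λ y z e → isZero-*-idem (tail x ⊕ y) z
             (trans (⊕-assoc (tail x) y z) (trans (cong (tail x ⊕_) e) tails))) ⟩
    subsetSum (isEqual n ∘ suc) (isZero ∘ (tail x ⊕_)) (map tail xs)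
      ≡⟨ subsetSum-total (suc r) _ _ (map tail xs) (Degree<-translate (suc r) (tail x) isZero (isZero-degree r))
           (λ j a j<1+r e → binomial-odd r j a (ℕ.≤-<-trans (ℕ.s≤s⁻¹ j<1+r) (r<2^r r))
             (trans (cong suc (trans e (length-map tail xs))) p)) ⟩
    isZero (tail x ⊕ total (map tail xs))
      ≡⟨ cong isZero tails ⟩
    isZero {r} 𝟎
      ≡⟨ isZero-𝟎 r ⟩
    1ℙ ∎

charProduct≡2^*oddPart : ∀ r xs → charProduct r xs ≡ ℤ.+ (2 ^ (2^ r ∸1)) ℤ.* oddPart r xs
charProduct≡2^*oddPart zero    xs = sym (ℤ.*-identityˡ _)
charProduct≡2^*oddPart (suc r) xs = begin
  charProduct (suc r) xs
    ≡⟨ ⊛-cong (charProduct≡2^*oddPart r ∘ map tail) (λ ys → trans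
         (cong (twistFactor headSign ys ℤ.*_) (charProduct≡2^*oddPart r (map tail ys)))
         (x∙yz≈y∙xz (twistFactor headSign ys) c _)) xs ⟩
  ((λ ys → c ℤ.* V ys) ⊛ (λ ys → c ℤ.* twist headSign V ys)) xs
    ≡⟨ ⊛-scaleˡ c V _ xs ⟩
  c ℤ.* (V ⊛ (λ ys → c ℤ.* twist headSign V ys)) xs
    ≡⟨ cong (c ℤ.*_) (⊛-scaleʳ c V _ xs) ⟩
  c ℤ.* (c ℤ.* (V ⊛ twist headSign V) xs)
    ≡⟨ cong (λ z → c ℤ.* (c ℤ.* z)) (double xs) ⟩
  c ℤ.* (c ℤ.* (ℤ.+ 2 ℤ.* oddPart (suc r) xs))
    ≡⟨ trans (sym (ℤ.*-assoc c c _)) (sym (ℤ.*-assoc (c ℤ.* c) (ℤ.+ 2) _)) ⟩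
  c ℤ.* c ℤ.* ℤ.+ 2 ℤ.* oddPart (suc r) xs
    ≡⟨ cong (ℤ._* oddPart (suc r) xs) powers ⟩
  ℤ.+ (2 ^ (2^ suc r ∸1)) ℤ.* oddPart (suc r) xs ∎
  where
  open ≡-Reasoning
  open import Algebra.Properties.CommutativeSemigroup ℤ.*-commutativeSemigroup using (x∙yz≈y∙xz)
  V = pull tail (oddPart r)
  e = 2^ r ∸1
  c = ℤ.+ (2 ^ e)
  powers : c ℤ.* c ℤ.* ℤ.+ 2 ≡ ℤ.+ (2 ^ (2^ suc r ∸1))
  powers = begin
    c ℤ.* c ℤ.* ℤ.+ 2                ≡⟨ cong (ℤ._* ℤ.+ 2) (ℤ.pos-* (2 ^ e) (2 ^ e)) ⟨
    ℤ.+ (2 ^ e ℕ.* 2 ^ e) ℤ.* ℤ.+ 2  ≡⟨ ℤ.pos-* (2 ^ e ℕ.* 2 ^ e) 2 ⟨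
    ℤ.+ (2 ^ e ℕ.* 2 ^ e ℕ.* 2)      ≡⟨ cong ℤ.+_ (ℕ.*-comm (2 ^ e ℕ.* 2 ^ e) 2) ⟩
    ℤ.+ (2 ℕ.* (2 ^ e ℕ.* 2 ^ e))    ≡⟨ cong (λ k → ℤ.+ (2 ℕ.* k)) (ℕ.^-distribˡ-+-* 2 e e) ⟨
    ℤ.+ (2 ^ suc (e ℕ.+ e))          ∎
  double : ∀ ys → (V ⊛ twist headSign V) ys ≡ ℤ.+ 2 ℤ.* oddPart (suc r) ys
  -- The empty list offers no Leibniz halves to pair. There V already vanishes because 0 ≠ 2^r,
  -- which agrees with the value 0 chosen in `oddPart`.
  double [] with oddPart-spec r []
  ... | inj₁ (z , _)       = cong (ℤ._* twist headSign V []) z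
  ... | inj₂ ((p , _) , _) = contradiction p (ℕ.<⇒≢ (ℕ.m^n>0 2 r))
  double (x ∷ ys) = begin
    (∂ x V ⊛ twist headSign V) ys ℤ.+ (V ⊛ ∂ x (twist headSign V)) ys
      ≡⟨ cong (ℤ._+_ ((∂ x V ⊛ twist headSign V) ys)) (twist-Leibniz headSign headSign-square V x ys) ⟩
    (∂ x V ⊛ twist headSign V) ys ℤ.+ twistFactor headSign (x ∷ ys) ℤ.* (∂ x V ⊛ twist headSign V) ys
      ≡⟨ cong (λ s → (∂ x V ⊛ twist headSign V) ys ℤ.+ s ℤ.* (∂ x V ⊛ twist headSign V) ys) (head-total (x ∷ ys)) ⟩
    _ ≡⟨ keepEven-double (head (total (x ∷ ys))) ((∂ x V ⊛ twist headSign V) ys) ⟩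
    _ ∎

-- Diagonalisation of the circulant

dot : ∀ {r} → H r → H r → Parity
dot []      []      = 0ℙ
dot (p ∷ a) (q ∷ x) = (p ℙ.* q) ℙ.+ dot a x

dot-comm : ∀ {r} (a x : H r) → dot a x ≡ dot x a
dot-comm []      []      = refl
dot-comm (p ∷ a) (q ∷ x) = cong₂ ℙ._+_ (ℙ.*-comm p q) (dot-comm a x)

dot-⊕ʳ : ∀ {r} (a x y : H r) → dot a (x ⊕ y) ≡ dot a x ℙ.+ dot a y
dot-⊕ʳ []      []      []      = refl
dot-⊕ʳ (p ∷ a) (q ∷ x) (s ∷ y) = trans (cong₂ ℙ._+_ (ℙ.*-distribˡ-+ p q s) (dot-⊕ʳ a x y))
                                        (+-interchange (p ℙ.* q) _ _ _)

dot-𝟎 : ∀ {r} (x : H r) → dot 𝟎 x ≡ 0ℙ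
dot-𝟎 []      = refl
dot-𝟎 (q ∷ x) = dot-𝟎 x

dot-nondegenerate : ∀ {r} (a : H r) → a ≢ 𝟎 → ∃ λ b → dot a b ≡ 1ℙ
dot-nondegenerate []       a≢𝟎 = contradiction refl a≢𝟎
dot-nondegenerate (1ℙ ∷ a) a≢𝟎 = (1ℙ ∷ 𝟎) , cong (1ℙ ℙ.+_) (trans (dot-comm a 𝟎) (dot-𝟎 a))
dot-nondegenerate (0ℙ ∷ a) a≢𝟎 with b , p ← dot-nondegenerate a (a≢𝟎 ∘ cong (0ℙ ∷_)) = (0ℙ ∷ b) , p

χ : ∀ {r} → H r → H r → ℤ
χ a x = sgn (dot a x)

χ-comm : ∀ {r} (a x : H r) → χ a x ≡ χ x a
χ-comm a x = cong sgn (dot-comm a x)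

χ-⊕ʳ : ∀ {r} (a x y : H r) → χ a (x ⊕ y) ≡ χ a x ℤ.* χ a y
χ-⊕ʳ a x y = trans (cong sgn (dot-⊕ʳ a x y)) (sgn-+ (dot a x) (dot a y))

χ-⊕ˡ : ∀ {r} (a b x : H r) → χ (a ⊕ b) x ≡ χ a x ℤ.* χ b x
χ-⊕ˡ a b x = trans (χ-comm (a ⊕ b) x) (trans (χ-⊕ʳ x a b) (cong₂ ℤ._*_ (χ-comm x a) (χ-comm x b)))

open SemiringSum ℤ.+-*-semiring using ()
  renaming (sum to Σℤ; sum-remove to Σℤ-remove; sum-cong-≗ to Σℤ-cong; sum-replicate-zero to Σℤ-0;
            sum-permute to Σℤ-permute; *-distribʳ-sum to Σℤ-*ʳ)

Σℤ-single : ∀ {n} (f : Fin n → ℤ) i → (∀ k → k ≢ i → f k ≡ 0ℤ) → Σℤ f ≡ f i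
Σℤ-single {suc n} f i off = begin
  Σℤ f                        ≡⟨ Σℤ-remove {i = i} f ⟩
  f i ℤ.+ Σℤ (f ∘ punchIn i)  ≡⟨ cong (ℤ._+_ (f i)) (Σℤ-cong (λ k → off _ (punchInᵢ≢i i k))) ⟩
  f i ℤ.+ Σℤ {n} (λ _ → 0ℤ)   ≡⟨ cong (ℤ._+_ (f i)) (Σℤ-0 n) ⟩
  f i ℤ.+ 0ℤ                  ≡⟨ ℤ.+-identityʳ (f i) ⟩
  f i                         ∎
  where open ≡-Reasoning

i≡-i⇒i≡0 : ∀ i → i ≡ ℤ.- i → i ≡ 0ℤ
i≡-i⇒i≡0 (ℤ.+ zero) _ = refl

⊕-shift-↔ : ∀ {r} → H r → H r ↔ H r
⊕-shift-↔ b = mk↔ₛ′ (_⊕ b) (_⊕ b) cancel cancel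
  where
  cancel : ∀ x → (x ⊕ b) ⊕ b ≡ x
  cancel x = trans (⊕-assoc x b b) (trans (cong (x ⊕_) (⊕-self b)) (trans (⊕-comm x 𝟎) (⊕-identityˡ x)))

point : ∀ {r} → H r → H r → ℤ
point x y = if ⌊ x ≟ᴴ y ⌋ then 1ℤ else 0ℤ

point-≡ : ∀ {r} (x : H r) → point x x ≡ 1ℤ
point-≡ x with x ≟ᴴ x
... | yes _  = refl
... | no x≢x = contradiction refl x≢x

point-≢ : ∀ {r} (x y : H r) → x ≢ y → point x y ≡ 0ℤ
point-≢ x y x≢y with x ≟ᴴ y
... | yes x≡y = contradiction x≡y x≢y
... | no _    = refl

const : {A : Set} → ℤ → Series A
const c xs = c ℤ.* 𝟏 xs

const-⊛ : {A : Set} (c : ℤ) (F : Series A) → const c ⊛ F ≗ λ xs → c ℤ.* F xs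
const-⊛ c F xs = trans (⊛-scaleˡ c 𝟏 F xs) (cong (c ℤ.*_) (⊛-identityˡ F xs))

Σˢ ∏ˢ : ∀ {A : Set} {n} → (Fin n → Series A) → Series A
Σˢ = F.foldr _⊞_ 𝟘
∏ˢ = F.foldr _⊛_ 𝟏

module _ {A : Set} where
  open CommutativeRing (Series-commutativeRing A) using (*-commutativeMonoid)

  ∏ˢ-cong : ∀ {n} {f g : Fin n → Series A} → (∀ i → f i ≗ g i) → ∏ˢ f ≗ ∏ˢ g
  ∏ˢ-cong = CommutativeMonoidSum.sum-cong-≋ *-commutativeMonoid

  ∏ˢ-permute : ∀ {m n} (f : Fin n → Series A) (π : Fin m ↔ Fin n) → ∏ˢ f ≗ ∏ˢ (f ∘ Inverse.to π)
  ∏ˢ-permute = CommutativeMonoidSum.sum-permute *-commutativeMonoid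

  ∏ˢ-↑ : ∀ m {n} (f : Fin (m ℕ.+ n) → Series A) → ∏ˢ f ≗ ∏ˢ (λ i → f (i ↑ˡ n)) ⊛ ∏ˢ (λ j → f (m ↑ʳ j))
  ∏ˢ-↑ zero    f xs = sym (⊛-identityˡ (∏ˢ f) xs)
  ∏ˢ-↑ (suc m) f xs = trans (⊛-cong {F = f zero} (λ _ → refl) (∏ˢ-↑ m (f ∘ suc)) xs)
                            (sym (⊛-assoc (f zero) _ _ xs))

  ∏ˢ-twist : ∀ s {n} (f : Fin n → Series A) → ∏ˢ (twist s ∘ f) ≗ twist s (∏ˢ f)
  ∏ˢ-twist s {zero}  f xs = sym (twist-𝟏 s xs)
  ∏ˢ-twist s {suc n} f xs = trans (⊛-cong {F = twist s (f zero)} (λ _ → refl) (∏ˢ-twist s (f ∘ suc)) xs)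
                                  (sym (twist-⊛ s (f zero) (∏ˢ (f ∘ suc)) xs))

  Σˢ-apply : ∀ {n} (f : Fin n → Series A) xs → Σˢ f xs ≡ Σℤ (λ i → f i xs)
  Σˢ-apply {zero}  f xs = refl
  Σˢ-apply {suc n} f xs = cong (ℤ._+_ (f zero xs)) (Σˢ-apply (f ∘ suc) xs)

  ∏ˢ-const : ∀ n c → ∏ˢ {A} {n} (λ _ → const c) ≗ const (c ℤ.^ n)
  ∏ˢ-const zero    c xs = sym (ℤ.*-identityˡ (𝟏 xs))
  ∏ˢ-const (suc n) c xs = begin
    (const c ⊛ ∏ˢ {n = n} (λ _ → const c)) xs   ≡⟨ const-⊛ c (∏ˢ {n = n} (λ _ → const c)) xs ⟩
    c ℤ.* ∏ˢ {n = n} (λ _ → const c) xs         ≡⟨ cong (c ℤ.*_) (∏ˢ-const n c xs) ⟩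
    c ℤ.* (c ℤ.^ n ℤ.* 𝟏 xs)                    ≡⟨ ℤ.*-assoc c _ _ ⟨
    c ℤ.* c ℤ.^ n ℤ.* 𝟏 xs                      ∎
    where open ≡-Reasoning

∏ˢ-pull : ∀ {A B : Set} (h : B → A) {n} (f : Fin n → Series A) → ∏ˢ (pull h ∘ f) ≗ pull h (∏ˢ f)
∏ˢ-pull h {zero}  f xs = sym (pull-𝟏 h xs)
∏ˢ-pull h {suc n} f xs = trans (⊛-cong {F = pull h (f zero)} (λ _ → refl) (∏ˢ-pull h (f ∘ suc)) xs)
                               (sym (pull-⊛ h (f zero) (∏ˢ (f ∘ suc)) xs))

linear-0∷ : ∀ {r} (a : H r) → linear (χ (0ℙ ∷ a)) ≗ pull tail (linear (χ a))
linear-0∷ a []                = refl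
linear-0∷ a ((p ∷ x) ∷ [])    = refl
linear-0∷ a (_ ∷ _ ∷ _)       = refl

linear-1∷ : ∀ {r} (a : H r) → linear (χ (1ℙ ∷ a)) ≗ twist headSign (pull tail (linear (χ a)))
linear-1∷ a []                = refl
linear-1∷ a ((p ∷ x) ∷ [])    = trans (sgn-+ p (dot a x)) (cong (ℤ._* χ a x) (sym (ℤ.*-identityʳ (sgn p))))
linear-1∷ a (x ∷ y ∷ xs)      = sym (ℤ.*-zeroʳ (twistFactor headSign (x ∷ y ∷ xs)))

⊎↔H : ∀ {r} → (H r ⊎ H r) ↔ H (suc r)
⊎↔H = mk↔ₛ′ (λ { (inj₁ x) → 0ℙ ∷ x ; (inj₂ x) → 1ℙ ∷ x })
            (λ { (0ℙ ∷ x) → inj₁ x ; (1ℙ ∷ x) → inj₂ x })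
            (λ { (0ℙ ∷ x) → refl ; (1ℙ ∷ x) → refl })
            (λ { (inj₁ x) → refl ; (inj₂ x) → refl })

-- The recursion lists the characters in an order of its own. Leaving the size n existential lets it
-- double as n + n without transport along 2^r; permutation invariance of the product later replaces
-- this order by the given one.
charProduct-enum : ∀ r → ∃ λ n → ∃ λ (e : Fin n ↔ H r) → ∏ˢ (λ i → linear (χ (Inverse.to e i))) ≗ charProduct r
charProduct-enum zero = 1 , e , eq
  where
  e : Fin 1 ↔ H 0
  e = mk↔ₛ′ (λ _ → []) (λ _ → zero) (λ { [] → refl }) (λ { zero → refl })
  eq : linear (χ []) ⊛ 𝟏 ≗ linear (λ _ → 1ℤ)
  eq xs = trans (⊛-comm _ 𝟏 xs) (trans (⊛-identityˡ (linear (χ [])) xs) (lin xs))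
    where
    lin : linear (χ []) ≗ linear (λ _ → 1ℤ)
    lin []          = refl
    lin ([] ∷ [])   = refl
    lin (_ ∷ _ ∷ _) = refl
charProduct-enum (suc r) with n , e , eq ← charProduct-enum r = n ℕ.+ n , e′ , λ xs → begin
  ∏ˢ (λ i → linear (χ (to′ i))) xs
    ≡⟨ ∏ˢ-↑ n (λ i → linear (χ (to′ i))) xs ⟩
  (∏ˢ (λ i → linear (χ (to′ (i ↑ˡ n)))) ⊛ ∏ˢ (λ i → linear (χ (to′ (n ↑ʳ i))))) xs
    ≡⟨ ⊛-cong (∏ˢ-cong (λ i ys → trans (cong (λ a → linear (χ a) ys) (toˡ i)) (linear-0∷ (to i) ys)))
              (∏ˢ-cong (λ i ys → trans (cong (λ a → linear (χ a) ys) (toʳ i)) (linear-1∷ (to i) ys))) xs ⟩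
  (∏ˢ (pull tail ∘ L) ⊛ ∏ˢ (twist headSign ∘ (pull tail ∘ L))) xs
    ≡⟨ ⊛-cong (∏ˢ-pull tail L) (∏ˢ-twist headSign (pull tail ∘ L)) xs ⟩
  (pull tail (∏ˢ L) ⊛ twist headSign (∏ˢ (pull tail ∘ L))) xs
    ≡⟨ ⊛-cong (eq ∘ map tail) (λ ys → cong (twistFactor headSign ys ℤ.*_)
         (trans (∏ˢ-pull tail L ys) (eq (map tail ys)))) xs ⟩
  charProduct (suc r) xs ∎
  where
  open ≡-Reasoning
  open Inverse e using (to)
  L = λ i → linear (χ (to i))
  e′ : Fin (n ℕ.+ n) ↔ H (suc r)
  e′ = ↔-trans +↔⊎ (↔-trans (e ⊎-↔ e) ⊎↔H)
  open Inverse e′ using () renaming (to to to′)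
  toˡ : ∀ i → to′ (i ↑ˡ n) ≡ 0ℙ ∷ to i
  toˡ i rewrite splitAt-↑ˡ n i n = refl
  toʳ : ∀ i → to′ (n ↑ʳ i) ≡ 1ℙ ∷ to i
  toʳ i rewrite splitAt-↑ʳ n n i = refl

module Diagonalisation {r n : ℕ} (order : Fin n ↔ H r) where
  open Inverse order using (to; from; strictlyInverseˡ; strictlyInverseʳ)
  open Exterior (Series-commutativeRing (H r))
  open Determinant (CommutativeRing.rawRing (Series-commutativeRing (H r))) using (Matrix; det)
  open ≡-Reasoning

  C X : Matrix n
  C i j = linear (point (to i ⊕ to j))
  X i j = const (χ (to i) (to j))

  eigenvalue : Fin n → Series (H r)
  eigenvalue i = linear (χ (to i))

  ∏-eigenvalue : ∏ˢ eigenvalue ≗ charProduct r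
  ∏-eigenvalue xs with m , e , eq ← charProduct-enum r = begin
    ∏ˢ eigenvalue xs
      ≡⟨ ∏ˢ-permute eigenvalue (↔-trans e (↔-sym order)) xs ⟩
    ∏ˢ (λ i → linear (χ (to (from (Inverse.to e i))))) xs
      ≡⟨ ∏ˢ-cong (λ i ys → cong (λ a → linear (χ a) ys) (strictlyInverseˡ (Inverse.to e i))) xs ⟩
    ∏ˢ (λ i → linear (χ (Inverse.to e i))) xs
      ≡⟨ eq xs ⟩
    charProduct r xs ∎

  Σ-point : ∀ (f : H r → ℤ) b y → Σℤ (λ k → f (to k) ℤ.* point (to k ⊕ b) y) ≡ f (y ⊕ b)
  Σ-point f b y = begin
    Σℤ (λ k → f (to k) ℤ.* point (to k ⊕ b) y)
      ≡⟨ Σℤ-single _ (from (y ⊕ b)) (λ k k≢ → trans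
           (cong (f (to k) ℤ.*_) (point-≢ (to k ⊕ b) y (λ eq → k≢ (trans (sym (strictlyInverseʳ k))
             (cong from (trans (sym (cancel (to k))) (cong (_⊕ b) eq)))))))
           (ℤ.*-zeroʳ (f (to k)))) ⟩
    f (to (from (y ⊕ b))) ℤ.* point (to (from (y ⊕ b)) ⊕ b) y
      ≡⟨ cong (λ x → f x ℤ.* point (x ⊕ b) y) (strictlyInverseˡ (y ⊕ b)) ⟩
    f (y ⊕ b) ℤ.* point ((y ⊕ b) ⊕ b) y
      ≡⟨ cong (λ x → f (y ⊕ b) ℤ.* point x y) (cancel y) ⟩
    f (y ⊕ b) ℤ.* point y y
      ≡⟨ trans (cong (f (y ⊕ b) ℤ.*_) (point-≡ y)) (ℤ.*-identityʳ (f (y ⊕ b))) ⟩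
    f (y ⊕ b) ∎
    where cancel = Inverse.strictlyInverseˡ (⊕-shift-↔ b)

  X⊡C : ∀ i j → (X ⊡ C) i j ≗ eigenvalue i ⊛ X i j
  X⊡C i j xs = begin
    Σˢ (λ k → X i k ⊛ C k j) xs
      ≡⟨ Σˢ-apply (λ k → X i k ⊛ C k j) xs ⟩
    Σℤ (λ k → (X i k ⊛ C k j) xs)
      ≡⟨ Σℤ-cong (λ k → const-⊛ (χ (to i) (to k)) (C k j) xs) ⟩
    Σℤ (λ k → χ (to i) (to k) ℤ.* C k j xs)
      ≡⟨ at xs ⟩
    χ (to i) (to j) ℤ.* eigenvalue i xs
      ≡⟨ const-⊛ (χ (to i) (to j)) (eigenvalue i) xs ⟨
    (X i j ⊛ eigenvalue i) xs
      ≡⟨ ⊛-comm (X i j) (eigenvalue i) xs ⟩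
    (eigenvalue i ⊛ X i j) xs ∎
    where
    zeros : Σℤ (λ k → χ (to i) (to k) ℤ.* 0ℤ) ≡ χ (to i) (to j) ℤ.* 0ℤ
    zeros = trans (Σℤ-cong (λ k → ℤ.*-zeroʳ (χ (to i) (to k)))) (trans (Σℤ-0 n) (sym (ℤ.*-zeroʳ (χ (to i) (to j)))))
    at : ∀ xs → Σℤ (λ k → χ (to i) (to k) ℤ.* C k j xs) ≡ χ (to i) (to j) ℤ.* eigenvalue i xs
    at []          = zeros
    at (y ∷ [])    = trans (Σ-point (χ (to i)) (to j) y) (trans (χ-⊕ʳ (to i) y (to j)) (ℤ.*-comm _ (χ (to i) (to j))))
    at (_ ∷ _ ∷ _) = zeros

  -- Translating the summation variable by some b with χ a b = -1 turns the sum into its own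
  -- negative.
  orthogonality : ∀ a → a ≢ 𝟎 → Σℤ (λ k → χ a (to k)) ≡ 0ℤ
  orthogonality a a≢𝟎 with b , dot≡1 ← dot-nondegenerate a a≢𝟎 = i≡-i⇒i≡0 _ (begin
    Σℤ (λ k → χ a (to k))
      ≡⟨ Σℤ-permute (λ k → χ a (to k)) (↔-trans order (↔-trans (⊕-shift-↔ b) (↔-sym order))) ⟩
    Σℤ (λ k → χ a (to (from (to k ⊕ b))))
      ≡⟨ Σℤ-cong (λ k → trans (cong (χ a) (strictlyInverseˡ (to k ⊕ b)))
           (trans (χ-⊕ʳ a (to k) b) (cong (λ p → χ a (to k) ℤ.* sgn p) dot≡1))) ⟩
    Σℤ (λ k → χ a (to k) ℤ.* -1ℤ)
      ≡⟨ Σℤ-*ʳ -1ℤ (λ k → χ a (to k)) ⟨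
    Σℤ (λ k → χ a (to k)) ℤ.* -1ℤ
      ≡⟨ trans (ℤ.*-comm _ -1ℤ) (ℤ.-1*i≡-i _) ⟩
    ℤ.- Σℤ (λ k → χ a (to k)) ∎)

  Σℤ-1 : ∀ m → Σℤ {m} (λ _ → 1ℤ) ≡ ℤ.+ m
  Σℤ-1 zero    = refl
  Σℤ-1 (suc m) = cong (ℤ._+_ 1ℤ) (Σℤ-1 m)

  δ-≡ : ∀ {m} (i : Fin m) xs → δ i i xs ≡ 𝟏 xs
  δ-≡ zero    xs = refl
  δ-≡ (suc i) xs = δ-≡ i xs

  δ-≢ : ∀ {m} (i j : Fin m) → i ≢ j → ∀ xs → δ i j xs ≡ 0ℤ
  δ-≢ zero    zero    i≢j xs = contradiction refl i≢j
  δ-≢ zero    (suc j) i≢j xs = refl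
  δ-≢ (suc i) zero    i≢j xs = refl
  δ-≢ (suc i) (suc j) i≢j xs = δ-≢ i j (i≢j ∘ cong suc) xs

  X⊡X : ∀ i j → (X ⊡ X) i j ≗ const (ℤ.+ n) ⊛ δ i j
  X⊡X i j xs = begin
    Σˢ (λ k → X i k ⊛ X k j) xs
      ≡⟨ Σˢ-apply (λ k → X i k ⊛ X k j) xs ⟩
    Σℤ (λ k → (X i k ⊛ X k j) xs)
      ≡⟨ Σℤ-cong (λ k → trans (const-⊛ (χ (to i) (to k)) (X k j) xs) (trans (sym (ℤ.*-assoc (χ (to i) (to k)) _ _))
           (cong (ℤ._* 𝟏 xs) (trans (cong (χ (to i) (to k) ℤ.*_) (χ-comm (to k) (to j))) (sym (χ-⊕ˡ (to i) (to j) (to k))))))) ⟩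
    Σℤ (λ k → χ (to i ⊕ to j) (to k) ℤ.* 𝟏 xs)
      ≡⟨ Σℤ-*ʳ (𝟏 xs) (λ k → χ (to i ⊕ to j) (to k)) ⟨
    Σℤ (λ k → χ (to i ⊕ to j) (to k)) ℤ.* 𝟏 xs
      ≡⟨ entry ⟩
    ℤ.+ n ℤ.* δ i j xs
      ≡⟨ const-⊛ (ℤ.+ n) (δ i j) xs ⟨
    (const (ℤ.+ n) ⊛ δ i j) xs ∎
    where
    entry : Σℤ (λ k → χ (to i ⊕ to j) (to k)) ℤ.* 𝟏 xs ≡ ℤ.+ n ℤ.* δ i j xs
    entry with i Fin.≟ j
    ... | yes refl = cong₂ ℤ._*_
      (trans (Σℤ-cong (λ k → cong sgn (trans (cong (λ a → dot a (to k)) (⊕-self (to i))) (dot-𝟎 (to k))))) (Σℤ-1 n))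
      (sym (δ-≡ i xs))
    ... | no i≢j = trans (cong (ℤ._* 𝟏 xs) (orthogonality (to i ⊕ to j) (λ eq → i≢j
        (trans (sym (strictlyInverseʳ i)) (trans (cong from (⊕≡𝟎⇒≡ _ _ eq)) (strictlyInverseʳ j))))))
      (trans (ℤ.*-zeroˡ (𝟏 xs)) (sym (trans (cong (ℤ.+ n ℤ.*_) (δ-≢ i j i≢j xs)) (ℤ.*-zeroʳ (ℤ.+ n)))))

  det-X² : det X ⊛ det X ≗ const ((ℤ.+ n) ℤ.^ n)
  det-X² xs = begin
    (det X ⊛ det X) xs                                    ≡⟨ det-⊡ X X xs ⟨
    det (X ⊡ X) xs                                        ≡⟨ det-cong X⊡X xs ⟩
    det {n} (λ i j → const (ℤ.+ n) ⊛ δ i j) xs                ≡⟨ det-scale {n} (λ _ → const (ℤ.+ n)) δ xs ⟩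
    (∏ˢ {n = n} (λ _ → const (ℤ.+ n)) ⊛ det (δ {n})) xs   ≡⟨ ⊛-cong (∏ˢ-const n (ℤ.+ n)) (det-δ n) xs ⟩
    (const ((ℤ.+ n) ℤ.^ n) ⊛ 𝟏) xs                          ≡⟨ const-⊛ ((ℤ.+ n) ℤ.^ n) 𝟏 xs ⟩
    const ((ℤ.+ n) ℤ.^ n) xs                                ∎

  det-X-C : det X ⊛ det C ≗ det X ⊛ ∏ˢ eigenvalue
  det-X-C xs = begin
    (det X ⊛ det C) xs                        ≡⟨ det-⊡ X C xs ⟨
    det (X ⊡ C) xs                            ≡⟨ det-cong X⊡C xs ⟩
    det (λ i j → eigenvalue i ⊛ X i j) xs     ≡⟨ det-scale eigenvalue X xs ⟩
    (∏ˢ eigenvalue ⊛ det X) xs                ≡⟨ ⊛-comm (∏ˢ eigenvalue) (det X) xs ⟩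
    (det X ⊛ ∏ˢ eigenvalue) xs                ∎

  -- The value of det X, sign included, is never determined. A second multiplication by det X turns
  -- the common factor into the integer n^n, which cancels pointwise.
  det-C : .{{ℤ.NonZero ((ℤ.+ n) ℤ.^ n)}} → det C ≗ charProduct r
  det-C xs = trans (ℤ.*-cancelˡ-≡ ((ℤ.+ n) ℤ.^ n) _ _ (begin
    (ℤ.+ n) ℤ.^ n ℤ.* det C xs
      ≡⟨ expand (det C) ⟨
    (det X ⊛ (det X ⊛ det C)) xs
      ≡⟨ ⊛-cong {F = det X} (λ _ → refl) det-X-C xs ⟩
    (det X ⊛ (det X ⊛ ∏ˢ eigenvalue)) xs
      ≡⟨ expand (∏ˢ eigenvalue) ⟩
    (ℤ.+ n) ℤ.^ n ℤ.* ∏ˢ eigenvalue xs ∎)) (∏-eigenvalue xs)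
    where
    expand : ∀ F → (det X ⊛ (det X ⊛ F)) xs ≡ (ℤ.+ n) ℤ.^ n ℤ.* F xs
    expand F = begin
      (det X ⊛ (det X ⊛ F)) xs         ≡⟨ ⊛-assoc (det X) (det X) F xs ⟨
      ((det X ⊛ det X) ⊛ F) xs         ≡⟨ ⊛-cong {G = F} det-X² (λ _ → refl) xs ⟩
      (const ((ℤ.+ n) ℤ.^ n) ⊛ F) xs     ≡⟨ const-⊛ ((ℤ.+ n) ℤ.^ n) F xs ⟩
      (ℤ.+ n) ℤ.^ n ℤ.* F xs             ∎

-- Taylor coefficients of formal polynomials

∈-elements : ∀ {r} (x : H r) → x ∈ elements r
∈-elements []       = here refl
∈-elements (0ℙ ∷ x) = ∈-++⁺ˡ (∈-map⁺ (0ℙ ∷_) (∈-elements x))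
∈-elements {suc r} (1ℙ ∷ x) = ∈-++⁺ʳ (map (0ℙ ∷_) (elements r)) (∈-map⁺ (1ℙ ∷_) (∈-elements x))

module _ {r : ℕ} where

  Agree-∀ : ∀ {e f : Exponent r} → Agree e f → e ≗ f
  Agree-∀ p x = All.lookup p (∈-elements x)

  ∀-Agree : ∀ {e f : Exponent r} → e ≗ f → Agree e f
  ∀-Agree p = All.universal p (elements r)

  lower : H r → Exponent r → Exponent r
  lower x e y = if ⌊ x ≟ᴴ y ⌋ then e y ∸ 1 else e y

  lower-cong : ∀ x {e f : Exponent r} → e ≗ f → lower x e ≗ lower x f
  lower-cong x p y with x ≟ᴴ y
  ... | yes _ = cong (_∸ 1) (p y)
  ... | no _  = p y

  lower-+ : ∀ x (e f : Exponent r) {k} → e x ≡ suc k → (λ y → lower x e y ℕ.+ f y) ≗ lower x (λ y → e y ℕ.+ f y)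
  lower-+ x e f p y with x ≟ᴴ y
  ... | yes refl rewrite p = refl
  ... | no _ = refl

  -- The derivatives of the monomial z^e at the origin. The truncated subtraction in `lower` is
  -- harmless: where it would leave the exponent 0 in place, the factor e(x) is already 0.
  derivatives : Exponent r → Series (H r)
  derivatives e []       = if ⌊ agree? e (λ _ → 0) ⌋ then 1ℤ else 0ℤ
  derivatives e (x ∷ xs) = ℤ.+ e x ℤ.* derivatives (lower x e) xs

  derivatives-cong : ∀ {e f} → e ≗ f → derivatives e ≗ derivatives f
  derivatives-cong {e} {f} p [] with agree? e (λ _ → 0) | agree? f (λ _ → 0)
  ... | yes _ | yes _ = refl
  ... | no _  | no _  = refl
  ... | yes a | no ¬b = contradiction (∀-Agree (λ x → trans (sym (p x)) (Agree-∀ a x))) ¬b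
  ... | no ¬a | yes b = contradiction (∀-Agree (λ x → trans (p x) (Agree-∀ b x))) ¬a
  derivatives-cong p (x ∷ xs) =
    cong₂ ℤ._*_ (cong ℤ.+_ (p x)) (derivatives-cong (lower-cong x p) xs)

  -- Lowering e and lowering e + f at x differ when e(x) = 0 and f(x) > 0; the common factor e(x)
  -- removes exactly this case.
  derivatives-+ˡ : ∀ x e f xs → ℤ.+ e x ℤ.* derivatives (λ y → lower x e y ℕ.+ f y) xs
                              ≡ ℤ.+ e x ℤ.* derivatives (lower x (λ y → e y ℕ.+ f y)) xs
  derivatives-+ˡ x e f xs with e x in eq
  ... | zero  = refl
  ... | suc k = cong (ℤ.+ suc k ℤ.*_) (derivatives-cong (lower-+ x e f eq) xs)

  derivatives-+ : ∀ e f → derivatives (λ x → e x ℕ.+ f x) ≗ derivatives e ⊛ derivatives f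
  derivatives-+ e f [] with agree? e (λ _ → 0) | agree? f (λ _ → 0) | agree? (λ x → e x ℕ.+ f x) (λ _ → 0)
  ... | yes _ | yes _ | yes _ = refl
  ... | yes a | yes b | no ¬c = contradiction (∀-Agree (λ x → cong₂ ℕ._+_ (Agree-∀ a x) (Agree-∀ b x))) ¬c
  ... | no ¬a | _     | yes c = contradiction (∀-Agree (λ x → ℕ.m+n≡0⇒m≡0 (e x) (Agree-∀ c x))) ¬a
  ... | no _  | yes _ | no _  = refl
  ... | no _  | no _  | no _  = refl
  ... | yes _ | no ¬b | yes c = contradiction (∀-Agree (λ x → ℕ.m+n≡0⇒n≡0 (e x) (Agree-∀ c x))) ¬b
  ... | yes _ | no _  | no _  = refl
  derivatives-+ e f (x ∷ xs) = begin
    ℤ.+ (e x ℕ.+ f x) ℤ.* derivatives (lower x (λ y → e y ℕ.+ f y)) xs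
      ≡⟨ ℤ.*-distribʳ-+ (derivatives (lower x (λ y → e y ℕ.+ f y)) xs) (ℤ.+ e x) (ℤ.+ f x) ⟩
    ℤ.+ e x ℤ.* derivatives (lower x (λ y → e y ℕ.+ f y)) xs ℤ.+ ℤ.+ f x ℤ.* derivatives (lower x (λ y → e y ℕ.+ f y)) xs
      ≡⟨ cong₂ ℤ._+_ (sym left) (sym right) ⟩
    _ ∎
    where
    open ≡-Reasoning
    left : (∂ x (derivatives e) ⊛ derivatives f) xs ≡ ℤ.+ e x ℤ.* derivatives (lower x (λ y → e y ℕ.+ f y)) xs
    left = begin
      (∂ x (derivatives e) ⊛ derivatives f) xs
        ≡⟨ ⊛-scaleˡ (ℤ.+ e x) (derivatives (lower x e)) (derivatives f) xs ⟩
      ℤ.+ e x ℤ.* (derivatives (lower x e) ⊛ derivatives f) xs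
        ≡⟨ cong (ℤ.+ e x ℤ.*_) (derivatives-+ (lower x e) f xs) ⟨
      ℤ.+ e x ℤ.* derivatives (λ y → lower x e y ℕ.+ f y) xs
        ≡⟨ derivatives-+ˡ x e f xs ⟩
      _ ∎
    right : (derivatives e ⊛ ∂ x (derivatives f)) xs ≡ ℤ.+ f x ℤ.* derivatives (lower x (λ y → e y ℕ.+ f y)) xs
    right = begin
      (derivatives e ⊛ ∂ x (derivatives f)) xs
        ≡⟨ ⊛-scaleʳ (ℤ.+ f x) (derivatives e) (derivatives (lower x f)) xs ⟩
      ℤ.+ f x ℤ.* (derivatives e ⊛ derivatives (lower x f)) xs
        ≡⟨ cong (ℤ.+ f x ℤ.*_) (derivatives-+ e (lower x f) xs) ⟨
      ℤ.+ f x ℤ.* derivatives (λ y → e y ℕ.+ lower x f y) xs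
        ≡⟨ cong (ℤ.+ f x ℤ.*_) (derivatives-cong (λ y → ℕ.+-comm (e y) _) xs) ⟩
      ℤ.+ f x ℤ.* derivatives (λ y → lower x f y ℕ.+ e y) xs
        ≡⟨ derivatives-+ˡ x f e xs ⟩
      ℤ.+ f x ℤ.* derivatives (lower x (λ y → f y ℕ.+ e y)) xs
        ≡⟨ cong (ℤ.+ f x ℤ.*_) (derivatives-cong (lower-cong x (λ y → ℕ.+-comm (f y) (e y))) xs) ⟩
      _ ∎

  -- A homomorphism into a lawful commutative ring, defined term by term, so that repeated exponents
  -- need no normal form.
  taylor : Poly r → Series (H r)
  taylor []            = 𝟘
  taylor ((c , e) ∷ p) xs = c ℤ.* derivatives e xs ℤ.+ taylor p xs

  taylor-++ : ∀ p q → taylor (p ++ q) ≗ taylor p ⊞ taylor q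
  taylor-++ []            q xs = sym (ℤ.+-identityˡ (taylor q xs))
  taylor-++ ((c , e) ∷ p) q xs =
    trans (cong (ℤ._+_ (c ℤ.* derivatives e xs)) (taylor-++ p q xs)) (sym (ℤ.+-assoc (c ℤ.* derivatives e xs) _ _))

  taylor-mulTerm : ∀ c e q → taylor (map (mulTerm (c , e)) q) ≗ (λ xs → c ℤ.* derivatives e xs) ⊛ taylor q
  taylor-mulTerm c e []            xs = sym (trans (⊛-comm (λ ys → c ℤ.* derivatives e ys) 𝟘 xs) (⊛-zeroˡ (λ ys → c ℤ.* derivatives e ys) xs))
  taylor-mulTerm c e ((d , f) ∷ q) xs = begin
    c ℤ.* d ℤ.* derivatives (λ x → e x ℕ.+ f x) xs ℤ.+ taylor (map (mulTerm (c , e)) q) xs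
      ≡⟨ cong₂ ℤ._+_ term (taylor-mulTerm c e q xs) ⟩
    (E ⊛ (λ ys → d ℤ.* derivatives f ys)) xs ℤ.+ (E ⊛ taylor q) xs
      ≡⟨ ⊛-distribˡ E (λ ys → d ℤ.* derivatives f ys) (taylor q) xs ⟨
    (E ⊛ taylor ((d , f) ∷ q)) xs ∎
    where
    open ≡-Reasoning
    E = λ ys → c ℤ.* derivatives e ys
    term : c ℤ.* d ℤ.* derivatives (λ x → e x ℕ.+ f x) xs ≡ (E ⊛ (λ ys → d ℤ.* derivatives f ys)) xs
    term = begin
      c ℤ.* d ℤ.* derivatives (λ x → e x ℕ.+ f x) xs
        ≡⟨ cong (c ℤ.* d ℤ.*_) (derivatives-+ e f xs) ⟩
      c ℤ.* d ℤ.* (derivatives e ⊛ derivatives f) xs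
        ≡⟨ ℤ.*-assoc c d _ ⟩
      c ℤ.* (d ℤ.* (derivatives e ⊛ derivatives f) xs)
        ≡⟨ cong (c ℤ.*_) (⊛-scaleʳ d (derivatives e) (derivatives f) xs) ⟨
      c ℤ.* (derivatives e ⊛ (λ ys → d ℤ.* derivatives f ys)) xs
        ≡⟨ ⊛-scaleˡ c (derivatives e) (λ ys → d ℤ.* derivatives f ys) xs ⟨
      _ ∎

  open RawRing (polyRing r) using () renaming (_*_ to _*ᴾ_; -_ to -ᴾ_; 1# to 1ᴾ; rawSemiring to polyRawSemiring)

  taylor-* : ∀ p q → taylor (p *ᴾ q) ≗ taylor p ⊛ taylor q
  taylor-* []            q xs = sym (⊛-zeroˡ (taylor q) xs)
  taylor-* ((c , e) ∷ p) q xs = begin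
    taylor (map (mulTerm (c , e)) q ++ p *ᴾ q) xs
      ≡⟨ taylor-++ (map (mulTerm (c , e)) q) (p *ᴾ q) xs ⟩
    taylor (map (mulTerm (c , e)) q) xs ℤ.+ taylor (p *ᴾ q) xs
      ≡⟨ cong₂ ℤ._+_ (taylor-mulTerm c e q xs) (taylor-* p q xs) ⟩
    ((λ ys → c ℤ.* derivatives e ys) ⊛ taylor q) xs ℤ.+ (taylor p ⊛ taylor q) xs
      ≡⟨ ⊛-distribʳ (taylor q) (λ ys → c ℤ.* derivatives e ys) (taylor p) xs ⟨
    _ ∎
    where open ≡-Reasoning

  taylor-neg : ∀ p → taylor (-ᴾ p) ≗ ⊟ taylor p
  taylor-neg []            xs = refl
  taylor-neg ((c , e) ∷ p) xs = trans
    (cong₂ ℤ._+_ (sym (ℤ.neg-distribˡ-* c (derivatives e xs))) (taylor-neg p xs))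
    (sym (ℤ.neg-distrib-+ (c ℤ.* derivatives e xs) (taylor p xs)))

  taylor-1 : taylor 1ᴾ ≗ 𝟏
  taylor-1 [] with agree? {r} (λ _ → 0) (λ _ → 0)
  ... | yes _ = refl
  ... | no ¬a = contradiction (∀-Agree (λ _ → refl)) ¬a
  taylor-1 (x ∷ xs) = refl

  taylor-var : ∀ x → taylor (var x) ≗ linear (point x)
  taylor-var x xs = trans (ℤ.+-identityʳ _) (trans (ℤ.*-identityˡ _) (at xs))
    where
    open ≡-Reasoning
    e : Exponent r
    e y = if ⌊ x ≟ᴴ y ⌋ then 1 else 0
    e-x : e x ≡ 1
    e-x with x ≟ᴴ x
    ... | yes _ = refl
    ... | no x≢x = contradiction refl x≢x
    lower-e : lower x e ≗ λ _ → 0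
    lower-e y with x ≟ᴴ y
    ... | yes _ = refl
    ... | no _ = refl
    at : ∀ xs → derivatives e xs ≡ linear (point x) xs
    at [] with agree? e (λ _ → 0)
    ... | yes a = contradiction (trans (sym e-x) (Agree-∀ a x)) (λ ())
    ... | no _  = refl
    at (y ∷ []) with x ≟ᴴ y
    ... | no _ = refl
    ... | yes refl = begin
      1ℤ ℤ.* derivatives (lower x e) []   ≡⟨ ℤ.*-identityˡ _ ⟩
      derivatives (lower x e) []          ≡⟨ derivatives-cong lower-e [] ⟩
      derivatives (λ _ → 0) []            ≡⟨ trans (sym (ℤ.*-identityˡ _)) (sym (ℤ.+-identityʳ _)) ⟩
      taylor 1ᴾ []                        ≡⟨ taylor-1 [] ⟩
      1ℤ                                  ∎
    at (y ∷ z ∷ xs) with x ≟ᴴ y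
    ... | no _ = refl
    ... | yes refl = trans (ℤ.*-identityˡ _) (cong (λ k → ℤ.+ k ℤ.* derivatives (lower z (lower x e)) xs) (lower-e z))

  private
    S = Series-commutativeRing (H r)
    module P = Determinant (polyRing r)
    module D = Determinant (CommutativeRing.rawRing S)
    open SemiringOps polyRawSemiring using () renaming (sum to Σᴾ; _^_ to _^ᴾ_)
    open SemiringOps (RawRing.rawSemiring (CommutativeRing.rawRing S)) using () renaming (_^_ to _^ˢ_)

  taylor-sum : ∀ {n} (f : Fin n → Poly r) → taylor (Σᴾ f) ≗ Σˢ (taylor ∘ f)
  taylor-sum {zero}  f xs = refl
  taylor-sum {suc n} f xs = trans (taylor-++ (f zero) _ xs) (cong (ℤ._+_ (taylor (f zero) xs)) (taylor-sum (f ∘ suc) xs))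

  taylor-sign : ∀ k → taylor ((-ᴾ 1ᴾ) ^ᴾ k) ≗ (⊟ 𝟏) ^ˢ k
  taylor-sign zero    = taylor-1
  taylor-sign (suc k) xs = trans (taylor-* (-ᴾ 1ᴾ) ((-ᴾ 1ᴾ) ^ᴾ k) xs)
    (⊛-cong (λ ys → trans (taylor-neg 1ᴾ ys) (cong ℤ.-_ (taylor-1 ys))) (taylor-sign k) xs)

  taylor-det : ∀ {n} (M : P.Matrix n) → taylor (P.det M) ≗ D.det (λ i j → taylor (M i j))
  taylor-det {zero}  M = taylor-1
  taylor-det {suc n} M xs = trans (taylor-sum summand xs) (Σˢ-cong term xs)
    where
    Σˢ-cong : ∀ {k} {f g : Fin k → Series (H r)} → (∀ i → f i ≗ g i) → Σˢ f ≗ Σˢ g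
    Σˢ-cong {zero}  p xs = refl
    Σˢ-cong {suc k} p xs = cong₂ ℤ._+_ (p zero xs) (Σˢ-cong (p ∘ suc) xs)
    summand : Fin (suc n) → Poly r
    summand j = ((-ᴾ 1ᴾ) ^ᴾ toℕ j) *ᴾ (M zero j *ᴾ P.det (P.minor M j))
    term : ∀ j → taylor (summand j) ≗
                 ((⊟ 𝟏) ^ˢ toℕ j) ⊛ (taylor (M zero j) ⊛ D.det (D.minor (λ i k → taylor (M i k)) j))
    term j ys = trans (taylor-* ((-ᴾ 1ᴾ) ^ᴾ toℕ j) (M zero j *ᴾ P.det (P.minor M j)) ys) (⊛-cong (taylor-sign (toℕ j))
      (λ zs → trans (taylor-* (M zero j) (P.det (P.minor M j)) zs)
        (⊛-cong {F = taylor (M zero j)} (λ _ → refl) (taylor-det (P.minor M j)) zs)) ys)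

-- Monomials as multisets of variables

module ElementsFold (_∙_ : ℕ → ℕ → ℕ) (ε : ℕ) (isCM : IsCommutativeMonoid _≡_ _∙_ ε) where
  open IsCommutativeMonoid isCM using (identityˡ; assoc; comm)

  fold : List ℕ → ℕ
  fold = foldr _∙_ ε

  fold-++ : ∀ xs ys → fold (xs ++ ys) ≡ fold xs ∙ fold ys
  fold-++ []       ys = sym (identityˡ (fold ys))
  fold-++ (x ∷ xs) ys = trans (cong (x ∙_) (fold-++ xs ys)) (sym (assoc x _ _))

  fold-elements : ∀ r (F : H (suc r) → ℕ) → fold (map F (elements (suc r))) ≡
                  fold (map (F ∘ (0ℙ ∷_)) (elements r)) ∙ fold (map (F ∘ (1ℙ ∷_)) (elements r))
  fold-elements r F = trans (cong fold (map-++ F (map (0ℙ ∷_) (elements r)) _))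
    (trans (fold-++ (map F (map (0ℙ ∷_) (elements r))) _)
    (cong₂ (λ a b → fold a ∙ fold b) (sym (map-∘ (elements r))) (sym (map-∘ (elements r)))))

  -- Serves two monoids: with multiplication it splits one factor off 𝐦!, and with addition it
  -- isolates the multiplicity of a single variable.
  fold-update : ∀ {r} (x : H r) {F G : H r → ℕ} c → (∀ y → x ≢ y → F y ≡ G y) → F x ≡ (c ∙ G x) →
                fold (map F (elements r)) ≡ c ∙ fold (map G (elements r))
  fold-update [] {F} {G} c off at = trans (cong (_∙ ε) at) (assoc c (G []) ε)
  fold-update {suc r} (0ℙ ∷ x) {F} {G} c off at = begin
    fold (map F (elements (suc r)))
      ≡⟨ fold-elements r F ⟩
    fold (map (F ∘ (0ℙ ∷_)) (elements r)) ∙ fold (map (F ∘ (1ℙ ∷_)) (elements r))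
      ≡⟨ cong₂ _∙_ (fold-update x c (λ y x≢y → off (0ℙ ∷ y) (x≢y ∘ Vec.∷-injectiveʳ)) at)
                   (cong fold (map-cong (λ y → off (1ℙ ∷ y) (λ ())) (elements r))) ⟩
    (c ∙ fold (map (G ∘ (0ℙ ∷_)) (elements r))) ∙ fold (map (G ∘ (1ℙ ∷_)) (elements r))
      ≡⟨ assoc c _ _ ⟩
    c ∙ (fold (map (G ∘ (0ℙ ∷_)) (elements r)) ∙ fold (map (G ∘ (1ℙ ∷_)) (elements r)))
      ≡⟨ cong (c ∙_) (fold-elements r G) ⟨
    _ ∎
    where open ≡-Reasoning
  fold-update {suc r} (1ℙ ∷ x) {F} {G} c off at = begin
    fold (map F (elements (suc r)))
      ≡⟨ fold-elements r F ⟩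
    fold (map (F ∘ (0ℙ ∷_)) (elements r)) ∙ fold (map (F ∘ (1ℙ ∷_)) (elements r))
      ≡⟨ cong₂ _∙_ (cong fold (map-cong (λ y → off (0ℙ ∷ y) (λ ())) (elements r)))
                   (fold-update x c (λ y x≢y → off (1ℙ ∷ y) (x≢y ∘ Vec.∷-injectiveʳ)) at) ⟩
    a ∙ (c ∙ b)
      ≡⟨ trans (sym (assoc a c b)) (trans (cong (_∙ b) (comm a c)) (assoc c a b)) ⟩
    c ∙ (a ∙ b)
      ≡⟨ cong (c ∙_) (fold-elements r G) ⟨
    _ ∎
    where
    open ≡-Reasoning
    a = fold (map (G ∘ (0ℙ ∷_)) (elements r))
    b = fold (map (G ∘ (1ℙ ∷_)) (elements r))

module _ {r : ℕ} where

  count : List (H r) → Exponent r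
  count []       y = 0
  count (x ∷ xs) y = (if ⌊ x ≟ᴴ y ⌋ then 1 else 0) ℕ.+ count xs y

  ∏!-0 : ∀ (e : Exponent r) → e ≗ (λ _ → 0) → ∏! e ≡ 1
  ∏!-0 e p = trans (cong product (map-cong (λ x → cong _! (p x)) (elements r))) (ones (elements r))
    where
    ones : ∀ (es : List (H r)) → product (map (λ _ → 1) es) ≡ 1
    ones []       = refl
    ones (_ ∷ es) = trans (ℕ.*-identityˡ _) (ones es)

  ∏!-lower : ∀ x (e : Exponent r) {k} → e x ≡ suc k → ∏! e ≡ e x ℕ.* ∏! (lower x e)
  ∏!-lower x e {k} p = fold-update x (e x) off at
    where
    open ElementsFold ℕ._*_ 1 ℕ.*-1-isCommutativeMonoid
    off : ∀ y → x ≢ y → e y ! ≡ lower x e y !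
    off y x≢y with x ≟ᴴ y
    ... | yes x≡y = contradiction x≡y x≢y
    ... | no _    = refl
    at : e x ! ≡ e x ℕ.* lower x e x !
    at with x ≟ᴴ x
    ... | no x≢x = contradiction refl x≢x
    ... | yes _ rewrite p = refl

  count-lower : ∀ x xs {e : Exponent r} {k} → e x ≡ suc k → lower x e ≗ count xs → e ≗ count (x ∷ xs)
  count-lower x xs {e} p q y with x ≟ᴴ y | q y
  ... | no _     | q′ = q′
  ... | yes refl | q′ rewrite p = cong suc q′

  lower-count : ∀ x xs {e : Exponent r} → e ≗ count (x ∷ xs) → lower x e ≗ count xs
  lower-count x xs p y with x ≟ᴴ y | p y
  ... | no _     | p′ = p′
  ... | yes refl | p′ = cong (_∸ 1) p′

  count-head : ∀ x xs → count (x ∷ xs) x ≡ suc (count xs x)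
  count-head x xs with x ≟ᴴ x
  ... | yes _  = refl
  ... | no x≢x = contradiction refl x≢x

  derivatives-≗ : ∀ xs (e : Exponent r) → e ≗ count xs → derivatives e xs ≡ ℤ.+ ∏! e
  derivatives-≗ [] e p with agree? e (λ _ → 0)
  ... | yes _ = cong ℤ.+_ (sym (∏!-0 e p))
  ... | no ¬a = contradiction (∀-Agree p) ¬a
  derivatives-≗ (x ∷ xs) e p = begin
    ℤ.+ e x ℤ.* derivatives (lower x e) xs   ≡⟨ cong (ℤ.+ e x ℤ.*_) (derivatives-≗ xs (lower x e) (lower-count x xs p)) ⟩
    ℤ.+ e x ℤ.* ℤ.+ ∏! (lower x e)           ≡⟨ ℤ.pos-* (e x) (∏! (lower x e)) ⟨
    ℤ.+ (e x ℕ.* ∏! (lower x e))             ≡⟨ cong ℤ.+_ (∏!-lower x e (trans (p x) (count-head x xs))) ⟨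
    ℤ.+ ∏! e                                 ∎
    where open ≡-Reasoning

  derivatives-≢ : ∀ xs (e : Exponent r) → ¬ (e ≗ count xs) → derivatives e xs ≡ 0ℤ
  derivatives-≢ [] e ¬p with agree? e (λ _ → 0)
  ... | yes a = contradiction (Agree-∀ a) ¬p
  ... | no _  = refl
  derivatives-≢ (x ∷ xs) e ¬p with e x in eq
  ... | zero  = refl
  ... | suc k = trans (cong (ℤ.+ suc k ℤ.*_) (derivatives-≢ xs (lower x e) (¬p ∘ count-lower x xs eq)))
                      (ℤ.*-zeroʳ (ℤ.+ suc k))

  -- Differentiating along a list with multiplicities 𝐦 and evaluating at the origin kills every
  -- monomial other than z^𝐦, and turns that one into 𝐦!.
  taylor-coeff : ∀ xs m → m ≗ count xs → ∀ (p : Poly r) → taylor p xs ≡ ℤ.+ ∏! m ℤ.* coeff m p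
  taylor-coeff xs m m≗ []            = sym (ℤ.*-zeroʳ (ℤ.+ ∏! m))
  taylor-coeff xs m m≗ ((c , e) ∷ p) with agree? e m
  ... | yes a = begin
    c ℤ.* derivatives e xs ℤ.+ taylor p xs
      ≡⟨ cong₂ ℤ._+_ (cong (c ℤ.*_) (trans (derivatives-≗ xs e (λ x → trans (Agree-∀ a x) (m≗ x)))
           (cong ℤ.+_ (cong product (map-cong (λ x → cong _! (Agree-∀ a x)) (elements r))))))
           (taylor-coeff xs m m≗ p) ⟩
    c ℤ.* ℤ.+ ∏! m ℤ.+ ℤ.+ ∏! m ℤ.* coeff m p
      ≡⟨ cong (ℤ._+ ℤ.+ ∏! m ℤ.* coeff m p) (ℤ.*-comm c (ℤ.+ ∏! m)) ⟩
    ℤ.+ ∏! m ℤ.* c ℤ.+ ℤ.+ ∏! m ℤ.* coeff m p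
      ≡⟨ ℤ.*-distribˡ-+ (ℤ.+ ∏! m) c (coeff m p) ⟨
    _ ∎
    where open ≡-Reasoning
  ... | no ¬a = begin
    c ℤ.* derivatives e xs ℤ.+ taylor p xs
      ≡⟨ cong (ℤ._+ taylor p xs) (trans (cong (c ℤ.*_) (derivatives-≢ xs e (λ q → ¬a (∀-Agree (λ x → trans (q x) (sym (m≗ x)))))))
           (ℤ.*-zeroʳ c)) ⟩
    0ℤ ℤ.+ taylor p xs
      ≡⟨ trans (ℤ.+-identityˡ _) (taylor-coeff xs m m≗ p) ⟩
    _ ∎
    where open ≡-Reasoning

  variables : Exponent r → List (H r)
  variables m = concatMap (λ x → replicate (m x) x) (elements r)

  count-++ : ∀ xs ys (y : H r) → count (xs ++ ys) y ≡ count xs y ℕ.+ count ys y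
  count-++ []       ys y = refl
  count-++ (x ∷ xs) ys y = trans (cong (ℕ._+_ (if ⌊ x ≟ᴴ y ⌋ then 1 else 0)) (count-++ xs ys y))
                                 (sym (ℕ.+-assoc (if ⌊ x ≟ᴴ y ⌋ then 1 else 0) _ _))

  multiplicity : Exponent r → H r → H r → ℕ
  multiplicity m y x = if ⌊ x ≟ᴴ y ⌋ then m x else 0

  count-replicate : ∀ k (x y : H r) → count (replicate k x) y ≡ (if ⌊ x ≟ᴴ y ⌋ then k else 0)
  count-replicate zero x y with x ≟ᴴ y
  ... | yes _ = refl
  ... | no _  = refl
  count-replicate (suc k) x y with x ≟ᴴ y | count-replicate k x y
  ... | yes _ | eq = cong suc eq
  ... | no _  | eq = eq

  count-variables : ∀ m → m ≗ count (variables m)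
  count-variables m y = sym (trans (counts (elements r)) (trans (fold-update y (m y) off at) zeros))
    where
    open ElementsFold ℕ._+_ 0 ℕ.+-0-isCommutativeMonoid
    counts : ∀ es → count (concatMap (λ x → replicate (m x) x) es) y ≡ sum (map (multiplicity m y) es)
    counts []       = refl
    counts (x ∷ es) = trans (count-++ (replicate (m x) x) _ y) (cong₂ ℕ._+_ (count-replicate (m x) x y) (counts es))
    off : ∀ x → y ≢ x → multiplicity m y x ≡ 0
    off x y≢x with x ≟ᴴ y
    ... | yes x≡y = contradiction (sym x≡y) y≢x
    ... | no _    = refl
    at : multiplicity m y y ≡ m y ℕ.+ 0
    at with y ≟ᴴ y
    ... | yes _  = sym (ℕ.+-identityʳ (m y))
    ... | no y≢y = contradiction refl y≢y
    zeros : m y ℕ.+ sum (map (λ _ → 0) (elements r)) ≡ m y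
    zeros = trans (cong (ℕ._+_ (m y)) (go (elements r))) (ℕ.+-identityʳ (m y))
      where
      go : ∀ (es : List (H r)) → sum (map (λ _ → 0) es) ≡ 0
      go []       = refl
      go (_ ∷ es) = go es

  length-variables : ∀ m → length (variables m) ≡ degree m
  length-variables m = go (elements r)
    where
    go : ∀ es → length (concatMap (λ x → replicate (m x) x) es) ≡ sum (map m es)
    go []       = refl
    go (x ∷ es) = trans (length-++ (replicate (m x) x)) (cong₂ ℕ._+_ (length-replicate (m x)) (go es))

  total-variables : ∀ m → total (variables m) ≡ σ m
  total-variables m = go (elements r)
    where
    open MonoidOps (H-rawMonoid r) renaming (_×_ to _·_)
    total-replicate : ∀ k x ys → total (replicate k x ++ ys) ≡ (k · x) ⊕ total ys
    total-replicate zero    x ys = sym (⊕-identityˡ (total ys))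
    total-replicate (suc k) x ys = trans (cong (x ⊕_) (total-replicate k x ys)) (sym (⊕-assoc x (k · x) _))
    go : ∀ es → total (concatMap (λ x → replicate (m x) x) es) ≡ foldr _⊕_ 𝟎 (map (λ x → m x · x) es)
    go []       = refl
    go (x ∷ es) = trans (total-replicate (m x) x _) (cong ((m x · x) ⊕_) (go es))

-- 2-adic valuations

Odd : ℕ → Set
Odd u = parity u ≡ 1ℙ

Odd-* : ∀ u v → Odd u → Odd v → Odd (u ℕ.* v)
Odd-* u v p q = trans (ℙ.*-homo-* u v) (cong₂ ℙ._*_ p q)

Odd-factorˡ : ∀ u v → Odd (u ℕ.* v) → Odd u
Odd-factorˡ u v p with parity u | trans (sym (ℙ.*-homo-* u v)) p
... | 1ℙ | _ = refl

double-¬Odd : ∀ k u → Odd u → u ≢ 2 ℕ.* k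
double-¬Odd k u p refl with () ← Odd-factorˡ 2 k p

-- A relation with an explicit odd cofactor multiplies and cancels by plain arithmetic; the bounded
-- search in `ν₂` has to be examined only once, at the end. Zero is excluded automatically, since
-- the cofactor is odd.
record HasValuation (a k : ℕ) : Set where
  constructor valuation
  field
    cofactor : ℕ
    odd      : Odd cofactor
    equation : k ≡ 2 ^ a ℕ.* cofactor

hasValuation-unique : ∀ {a b k} → HasValuation a k → HasValuation b k → a ≡ b
hasValuation-unique {a} {b} (valuation u u-odd p) (valuation v v-odd q) = go a b (trans (sym p) q)
  where
  go : ∀ a b → 2 ^ a ℕ.* u ≡ 2 ^ b ℕ.* v → a ≡ b
  go zero    zero    eq = refl
  go zero    (suc b) eq = contradiction (trans (sym (ℕ.*-identityˡ u)) (trans eq (ℕ.*-assoc 2 (2 ^ b) v))) (double-¬Odd (2 ^ b ℕ.* v) u u-odd)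
  go (suc a) zero    eq = contradiction (trans (sym (ℕ.*-identityˡ v)) (trans (sym eq) (ℕ.*-assoc 2 (2 ^ a) u))) (double-¬Odd (2 ^ a ℕ.* u) v v-odd)
  go (suc a) (suc b) eq = cong suc (go a b (ℕ.*-cancelˡ-≡ _ _ 2
    (trans (sym (ℕ.*-assoc 2 (2 ^ a) u)) (trans eq (ℕ.*-assoc 2 (2 ^ b) v)))))

hasValuation-* : ∀ {a b k l} → HasValuation a k → HasValuation b l → HasValuation (a ℕ.+ b) (k ℕ.* l)
hasValuation-* {a} {b} (valuation u u-odd refl) (valuation v v-odd refl) = valuation (u ℕ.* v) (Odd-* u v u-odd v-odd)
  (trans (interchange (2 ^ a) u (2 ^ b) v) (cong (ℕ._* (u ℕ.* v)) (sym (ℕ.^-distribˡ-+-* 2 a b))))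
  where open import Algebra.Properties.CommutativeSemigroup ℕ.*-commutativeSemigroup using (interchange)

even⇒double : ∀ k → parity k ≡ 0ℙ → ∃ λ h → k ≡ 2 ℕ.* h
even⇒double zero          p = 0 , refl
even⇒double (suc (suc k)) p with h , refl ← even⇒double k p = suc h , cong suc (sym (ℕ.+-suc h (h ℕ.+ 0)))

hasValuation-exists : ∀ k → k ≢ 0 → ∃ λ a → HasValuation a k
hasValuation-exists k = go k k ℕ.≤-refl
  where
  go : ∀ bound k → k ≤ bound → k ≢ 0 → ∃ λ a → HasValuation a k
  go bound k k≤ k≢0 with parity k in eq
  go bound k k≤ k≢0 | 1ℙ = 0 , valuation k eq (sym (ℕ.*-identityˡ k))
  go bound k k≤ k≢0 | 0ℙ with even⇒double k eq
  go bound       .(2 ℕ.* 0)     k≤ k≢0 | 0ℙ | zero  , refl = contradiction refl k≢0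
  go (suc bound) .(2 ℕ.* suc h) k≤ k≢0 | 0ℙ | suc h , refl
    with a , valuation u u-odd p ← go bound (suc h) (ℕ.≤-trans (ℕ.m≤n+m (suc h) h)
           (ℕ.≤-trans (ℕ.≤-reflexive (cong (λ l → h ℕ.+ suc l) (sym (ℕ.+-identityʳ h)))) (ℕ.s≤s⁻¹ k≤))) (λ ())
    = suc a , valuation u u-odd (trans (cong (2 ℕ.*_) p) (sym (ℕ.*-assoc 2 (2 ^ a) u)))

hasValuation-≢0 : ∀ {a k} → HasValuation a k → k ≢ 0
hasValuation-≢0 {a} (valuation u u-odd p) k≡0 with ℕ.m*n≡0⇒m≡0∨n≡0 (2 ^ a) (trans (sym p) k≡0)
... | inj₁ 2^a≡0 = contradiction 2^a≡0 (ℕ.≢-nonZero⁻¹ (2 ^ a) {{ℕ.m^n≢0 2 a}})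
... | inj₂ refl with () ← u-odd

-- Additivity and uniqueness suffice, whatever the valuation of c is. This removes 𝐦! from the
-- coefficient and from the multinomial simultaneously.
hasValuation-cancel : ∀ {e} c k l → HasValuation e (c ℕ.* k) → HasValuation e (c ℕ.* l) →
                      ∃ λ a → HasValuation a k × HasValuation a l
hasValuation-cancel {e} c k l ck cl
  with γ , vc ← hasValuation-exists c (λ { refl → hasValuation-≢0 ck refl })
     | a , vk ← hasValuation-exists k (λ { refl → hasValuation-≢0 ck (ℕ.*-zeroʳ c) })
     | b , vl ← hasValuation-exists l (λ { refl → hasValuation-≢0 cl (ℕ.*-zeroʳ c) })
  = a , vk , subst (λ b → HasValuation b l) (ℕ.+-cancelˡ-≡ γ b a (trans
      (hasValuation-unique (hasValuation-* vc vl) cl) (sym (hasValuation-unique (hasValuation-* vc vk) ck)))) vl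

2^∣⇒≤ : ∀ {a k} j → HasValuation a k → 2 ^ j ∣ k → j ≤ a
2^∣⇒≤ {a} j v@(valuation u u-odd p) (divides q eq)
  with b , vq ← hasValuation-exists q (λ { refl → hasValuation-≢0 v eq })
  = ℕ.≤-trans (ℕ.m≤n+m j b) (ℕ.≤-reflexive (hasValuation-unique
      (subst (HasValuation (b ℕ.+ j)) (sym eq) (hasValuation-* vq (valuation 1 refl (sym (ℕ.*-identityʳ (2 ^ j)))))) v))

-- The search descends from its bound, so it can stop neither above a, where no power divides k, nor
-- below a, since 2^a does.
exponent₂≤-hasValuation : ∀ {a k} → HasValuation a k → ∀ bound → a ≤ bound → exponent₂≤ bound k ≡ a
exponent₂≤-hasValuation v zero ℕ.z≤n = refl
exponent₂≤-hasValuation {a} {k} v@(valuation u u-odd p) (suc bound) a≤ with 2 ^ suc bound ∣? k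
... | yes 2^∣k = ℕ.≤-antisym (2^∣⇒≤ (suc bound) v 2^∣k) a≤
... | no ¬2^∣k = exponent₂≤-hasValuation v bound (ℕ.s≤s⁻¹ (ℕ.≤∧≢⇒< a≤
  (λ { refl → ¬2^∣k (subst (2 ^ suc bound ∣_) (sym p) (m∣m*n u)) })))

hasValuation-≤ : ∀ {a k} → HasValuation a k → a ≤ k
hasValuation-≤ {a} v@(valuation zero    u-odd p) = contradiction (trans p (ℕ.*-zeroʳ (2 ^ a))) (hasValuation-≢0 v)
hasValuation-≤ {a} (valuation (suc u) u-odd p) = ℕ.≤-trans (ℕ.<⇒≤ (r<2^r a))
  (ℕ.≤-trans (ℕ.m≤m*n (2 ^ a) (suc u)) (ℕ.≤-reflexive (sym p)))

ν₂-hasValuation : ∀ {a} z → HasValuation a ℤ.∣ z ∣ → ν₂ z ≡ fin a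
ν₂-hasValuation z v with ℤ.∣ z ∣
... | zero  = contradiction refl (hasValuation-≢0 v)
... | suc k = cong fin (exponent₂≤-hasValuation v (suc k) (hasValuation-≤ v))

-- Separate the even factors of (2m)! from the odd ones; the witness o is 1 · 3 ⋯ (2m - 1).
double-! : ∀ m → ∃ λ o → Odd o × (m ℕ.+ m) ! ≡ 2 ^ m ℕ.* (m ! ℕ.* o)
double-! zero    = 1 , refl , refl
double-! (suc m) with o , o-odd , p ← double-! m =
  suc (m ℕ.+ m) ℕ.* o , Odd-* (suc (m ℕ.+ m)) o odd-1+2m o-odd , (begin
    (suc m ℕ.+ suc m) !
      ≡⟨ cong (λ k → suc k !) (ℕ.+-suc m m) ⟩
    suc (suc (m ℕ.+ m)) ℕ.* (suc (m ℕ.+ m) ℕ.* (m ℕ.+ m) !)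
      ≡⟨ cong (λ k → suc (suc (m ℕ.+ m)) ℕ.* (suc (m ℕ.+ m) ℕ.* k)) p ⟩
    suc (suc (m ℕ.+ m)) ℕ.* (suc (m ℕ.+ m) ℕ.* (2 ^ m ℕ.* (m ! ℕ.* o)))
      ≡⟨ rearrange m (2 ^ m) (m !) o ⟩
    2 ^ suc m ℕ.* (suc m ! ℕ.* (suc (m ℕ.+ m) ℕ.* o)) ∎)
  where
  open ≡-Reasoning
  odd-1+2m : Odd (suc (m ℕ.+ m))
  odd-1+2m = trans (ℙ.+-homo-+ 1 (m ℕ.+ m)) (cong ℙ._⁻¹ (trans (ℙ.+-homo-+ m m) (ℙ.p+p≡0ℙ (parity m))))
  rearrange : ∀ m p f o → suc (suc (m ℕ.+ m)) ℕ.* (suc (m ℕ.+ m) ℕ.* (p ℕ.* (f ℕ.* o)))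
                        ≡ 2 ℕ.* p ℕ.* (suc m ℕ.* f ℕ.* (suc (m ℕ.+ m) ℕ.* o))
  rearrange = solve-∀

-- Doubling n adds n to the valuation of n!, by `double-!`, and n + (n - 1) = 2n - 1.
2^-!-hasValuation : ∀ r → HasValuation (2^ r ∸1) ((2 ^ r) !)
2^-!-hasValuation zero    = valuation 1 refl refl
2^-!-hasValuation (suc r) with o , o-odd , p ← double-! (2 ^ r) =
  subst (λ e → HasValuation e ((2 ^ suc r) !)) (cong₂ ℕ._+_ (2^≡1+2^∸1 r) (ℕ.+-identityʳ (2^ r ∸1)))
    (subst (HasValuation _) (sym (trans (cong (λ k → (2 ^ r ℕ.+ k) !) (ℕ.+-identityʳ (2 ^ r))) p))
      (hasValuation-* {2 ^ r} (valuation 1 refl (sym (ℕ.*-identityʳ (2 ^ (2 ^ r)))))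
        (hasValuation-* (2^-!-hasValuation r) (valuation {0} o o-odd (sym (ℕ.*-identityˡ o))))))

-- The multinomial coefficient is built up as a product of binomials, one for each entry of the
-- list.
product-!-∣ : ∀ {A : Set} (m : A → ℕ) es → product (map (λ x → m x !) es) ∣ sum (map m es) !
product-!-∣ m []       = ∣-refl
product-!-∣ m (x ∷ es) = ∣-trans (*-monoʳ-∣ (m x !) (product-!-∣ m es))
  (subst (λ k → m x ! ℕ.* k ! ∣ (m x ℕ.+ s) !) (ℕ.m+n∸m≡n (m x) s) (k![n∸k]!∣n! (ℕ.m≤m+n (m x) s)))
  where s = sum (map m es)

∏!-*-multinomial : ∀ {r} n (m : Exponent r) → degree m ≡ n → ∏! m ℕ.* (n !/∏! m) ≡ n !
∏!-*-multinomial {r} n m refl = m*[n/m]≡n {{∏!-nonZero m}} (product-!-∣ m (elements r))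

-- Coefficients of the determinant

taylor-detC : ∀ {r} (order : Fin (2 ^ r) ↔ H r) → taylor (detC order) ≗ charProduct r
taylor-detC {r} order xs = begin
  taylor (detC order) xs                       ≡⟨ taylor-det (circulant order) xs ⟩
  det (λ i j → taylor (circulant order i j)) xs ≡⟨ det-cong (λ i j → taylor-var (to i ⊕ to j)) xs ⟩
  det C xs                                     ≡⟨ det-C xs ⟩
  charProduct r xs                             ∎
  where
  open ≡-Reasoning
  open Inverse order using (to)
  open Diagonalisation order using (C; det-C)
  open Exterior (Series-commutativeRing (H r)) using (det-cong)
  open Determinant (CommutativeRing.rawRing (Series-commutativeRing (H r))) using (det)
  instance
    2^r≢0 : ℕ.NonZero (2 ^ r)
    2^r≢0 = ℕ.m^n≢0 2 r
    power≢0 : ℤ.NonZero ((ℤ.+ (2 ^ r)) ℤ.^ (2 ^ r))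
    power≢0 = ℤ.≢-nonZero (λ eq → ℕ.≢-nonZero⁻¹ (2 ^ r)
      (cong ℤ.∣_∣ (ℤ.i^n≡0⇒i≡0 (ℤ.+ (2 ^ r)) (2 ^ r) eq)))

∏!-*-coeff : ∀ {r} (order : Fin (2 ^ r) ↔ H r) m →
             ℤ.+ ∏! m ℤ.* coeff m (detC order) ≡ ℤ.+ (2 ^ (2^ r ∸1)) ℤ.* oddPart r (variables m)
∏!-*-coeff {r} order m = begin
  ℤ.+ ∏! m ℤ.* coeff m (detC order)                 ≡⟨ taylor-coeff (variables m) m (count-variables m) (detC order) ⟨
  taylor (detC order) (variables m)                 ≡⟨ taylor-detC order (variables m) ⟩
  charProduct r (variables m)                       ≡⟨ charProduct≡2^*oddPart r (variables m) ⟩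
  ℤ.+ (2 ^ (2^ r ∸1)) ℤ.* oddPart r (variables m)   ∎
  where open ≡-Reasoning

theorem6 : ∀ (r : ℕ) → r ≥ 1 → (order : Fin (2 ^ r) ↔ H r) →
    ∀ (m : Exponent r) → degree m ≡ 2 ^ r →
    (σ m ≢ 𝟎 → coeff m (detC order) ≡ 0ℤ)
    × (σ m ≡ 𝟎 →
    (ν₂ (coeff m (detC order)) ≡ ν₂ (+ ((2 ^ r) !/∏! m)))
    × coeff m (detC order) ≢ 0ℤ)
theorem6 r _ order m deg with oddPart-spec r (variables m)
-- The degree hypothesis fixes the length of `variables m`, so being balanced amounts to σ(𝐦) = 0,
-- and each case makes one of the two implications vacuous.
... | inj₁ (odd≡0 , unbalanced) =
  (λ _ → ℤ.*-cancelˡ-≡ (ℤ.+ ∏! m) _ 0ℤ {{∏!-nonZero m}} (begin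
    ℤ.+ ∏! m ℤ.* coeff m (detC order)                 ≡⟨ ∏!-*-coeff order m ⟩
    ℤ.+ (2 ^ (2^ r ∸1)) ℤ.* oddPart r (variables m)   ≡⟨ cong (ℤ.+ (2 ^ (2^ r ∸1)) ℤ.*_) odd≡0 ⟩
    ℤ.+ (2 ^ (2^ r ∸1)) ℤ.* 0ℤ                        ≡⟨ ℤ.*-zeroʳ (ℤ.+ (2 ^ (2^ r ∸1))) ⟩
    0ℤ                                                ≡⟨ ℤ.*-zeroʳ (ℤ.+ ∏! m) ⟨
    ℤ.+ ∏! m ℤ.* 0ℤ                                   ∎)) ,
  λ σ≡𝟎 → contradiction (trans (length-variables m) deg , trans (total-variables m) σ≡𝟎) unbalanced
  where open ≡-Reasoning
... | inj₂ ((_ , total≡𝟎) , odd) =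
  (λ σ≢𝟎 → contradiction (trans (sym (total-variables m)) total≡𝟎) σ≢𝟎) ,
  λ _ → same-valuation (hasValuation-cancel (∏! m) ℤ.∣ a ∣ ((2 ^ r) !/∏! m) ∏!*a ∏!*multinomial)
  where
  open ≡-Reasoning
  a = coeff m (detC order)
  ∏!*a : HasValuation (2^ r ∸1) (∏! m ℕ.* ℤ.∣ a ∣)
  ∏!*a = valuation ℤ.∣ oddPart r (variables m) ∣ odd (begin
    ∏! m ℕ.* ℤ.∣ a ∣
      ≡⟨ ℤ.abs-* (ℤ.+ ∏! m) a ⟨
    ℤ.∣ ℤ.+ ∏! m ℤ.* a ∣
      ≡⟨ cong ℤ.∣_∣ (∏!-*-coeff order m) ⟩
    ℤ.∣ ℤ.+ (2 ^ (2^ r ∸1)) ℤ.* oddPart r (variables m) ∣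
      ≡⟨ ℤ.abs-* (ℤ.+ (2 ^ (2^ r ∸1))) _ ⟩
    2 ^ (2^ r ∸1) ℕ.* ℤ.∣ oddPart r (variables m) ∣ ∎)
  ∏!*multinomial : HasValuation (2^ r ∸1) (∏! m ℕ.* ((2 ^ r) !/∏! m))
  ∏!*multinomial = subst (HasValuation _) (sym (∏!-*-multinomial (2 ^ r) m deg)) (2^-!-hasValuation r)
  same-valuation : (∃ λ k → HasValuation k ℤ.∣ a ∣ × HasValuation k ((2 ^ r) !/∏! m)) →
                   (ν₂ a ≡ ν₂ (+ ((2 ^ r) !/∏! m))) × a ≢ 0ℤ
  same-valuation (k , v , w) =
    trans (ν₂-hasValuation a v) (sym (ν₂-hasValuation (+ ((2 ^ r) !/∏! m)) w)) ,
    λ a≡0 → hasValuation-≢0 v (cong ℤ.∣_∣ a≡0)
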